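{- Let $A\in \mathbb{Z}^{m\times n}$, $b\in \mathbb{Z}^m$, and $P:=\{x:Ax\leq b\}$. For a nonempty face $F$ of $P$, let $A_F$ denote the row submatrix of $A$ corresponding to the inequalities of $Ax\leq b$ that hold with equality at every point of $F$ (the implicit equalities of $F$). Then the following are equivalent: (1) $Ax\leq b$ is totally dual $p$-adic for all primes $p$; (2) $Ax\leq b$ is totally dual $p$-adic and totally dual $q$-adic for some distinct primes $p,q$; (3) for every nonempty face $F$ of $P$, the GCD of the subdeterminants of $A_F$ of order $\operatorname{rank}(A_F)$ is $1$.
   Context: For a prime $p$, a $p$-adic rational is a number of the form $a/p^k$ with $a,k$ integers and $k\geq 0$; a vector is $p$-adic if all its entries are $p$-adic rationals. The system $Ax\leq b$ (with $A,b$ integral) is totally dual $p$-adic if for every $w\in\mathbb{Z}^n$ for which $\min\{b^\top y: A^\top y=w,\ y\geq \mathbf{0}\}$ has an optimal solution, it has a $p$-adic optimal solution.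
   Formalization: The points x of P, the inequalities defining its faces, and the dual solutions y (both feasible and optimal) range over the rationals instead of the reals; A, b and w are integral as in the statement. -}

module Defs where

open import Data.Nat as ℕ using (ℕ; zero; suc)
open import Data.Nat.Primality using (Prime)
open import Data.Integer as ℤ using (ℤ; +_)
open import Data.Integer.Divisibility using () renaming (_∣_ to _∣ℤ_)
open import Data.Rational as ℚ using (ℚ; 0ℚ)
open import Data.Fin using (Fin; zero; suc; punchIn)
import Data.Fin
open import Data.Product using (Σ; ∃; _×_; _,_)
open import Relation.Binary.PropositionalEquality using (_≡_; _≢_)
open import Relation.Nullary using (¬_)
open import Function.Definitions using (Injective)
open import Function.Bundles using (_⇔_)

Matrix : ℕ → ℕ → Set
Matrix m n = Fin m → Fin n → ℤ

IVec : ℕ → Set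
IVec n = Fin n → ℤ

QVec : ℕ → Set
QVec n = Fin n → ℚ

ι : ℤ → ℚ
ι z = z ℚ./ 1

Σℚ : ∀ {n} → (Fin n → ℚ) → ℚ
Σℚ {zero}  f = 0ℚ
Σℚ {suc n} f = f zero ℚ.+ Σℚ (λ i → f (suc i))

Σℤ : ∀ {n} → (Fin n → ℤ) → ℤ
Σℤ {zero}  f = + 0
Σℤ {suc n} f = f zero ℤ.+ Σℤ (λ i → f (suc i))

rowDot : ∀ {m n} → Matrix m n → Fin m → QVec n → ℚ
rowDot A i x = Σℚ (λ j → ι (A i j) ℚ.* x j)

colDot : ∀ {m n} → Matrix m n → Fin n → QVec m → ℚ
colDot A j y = Σℚ (λ i → ι (A i j) ℚ.* y i)

dotℤℚ : ∀ {m} → IVec m → QVec m → ℚ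
dotℤℚ b y = Σℚ (λ i → ι (b i) ℚ.* y i)

-- p-adic rationals: q = a / p^k with a ∈ ℤ, k ∈ ℕ
-- (written as q · p^k = a, equivalent since p^k ≠ 0 for a prime p)

IsPAdic : ℕ → ℚ → Set
IsPAdic p q = Σ ℤ λ a → Σ ℕ λ k → q ℚ.* ι (+ (p ℕ.^ k)) ≡ ι a

IsPAdicVec : ∀ {m} → ℕ → QVec m → Set
IsPAdicVec p y = ∀ i → IsPAdic p (y i)

DualFeasible : ∀ {m n} → Matrix m n → IVec n → QVec m → Set
DualFeasible A w y = (∀ j → colDot A j y ≡ ι (w j)) × (∀ i → 0ℚ ℚ.≤ y i)

DualOptimal : ∀ {m n} → Matrix m n → IVec m → IVec n → QVec m → Set
DualOptimal A b w y =
  DualFeasible A w y × (∀ y′ → DualFeasible A w y′ → dotℤℚ b y ℚ.≤ dotℤℚ b y′)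

TotallyDualPAdic : ∀ {m n} → ℕ → Matrix m n → IVec m → Set
TotallyDualPAdic p A b =
  ∀ w → (Σ _ λ y → DualOptimal A b w y) →
        Σ _ λ y → DualOptimal A b w y × IsPAdicVec p y

InP : ∀ {m n} → Matrix m n → IVec m → QVec n → Set
InP A b x = ∀ i → rowDot A i x ℚ.≤ ι (b i)

Valid : ∀ {m n} → Matrix m n → IVec m → QVec n → ℚ → Set
Valid A b c δ = ∀ x → InP A b x → Σℚ (λ j → c j ℚ.* x j) ℚ.≤ δ

InFace : ∀ {m n} → Matrix m n → IVec m → QVec n → ℚ → QVec n → Set
InFace A b c δ x = InP A b x × Σℚ (λ j → c j ℚ.* x j) ≡ δ

NonemptyFace : ∀ {m n} → Matrix m n → IVec m → QVec n → ℚ → Set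
NonemptyFace A b c δ = Valid A b c δ × Σ _ λ x → InFace A b c δ x

ImplicitEq : ∀ {m n} → Matrix m n → IVec m → QVec n → ℚ → Fin m → Set
ImplicitEq A b c δ i = ∀ x → InFace A b c δ x → rowDot A i x ≡ ι (b i)

RowsIndependent : ∀ {m n k} → Matrix m n → (Fin k → Fin m) → Set
RowsIndependent {k = k} A ρ =
  ∀ (λs : Fin k → ℚ) →
    (∀ j → Σℚ (λ t → λs t ℚ.* ι (A (ρ t) j)) ≡ 0ℚ) → ∀ t → λs t ≡ 0ℚ

IsRankOf : ∀ {m n} → Matrix m n → (Fin m → Set) → ℕ → Set
IsRankOf {m} A I r =
  (Σ (Fin r → Fin m) λ ρ → (∀ t → I (ρ t)) × RowsIndependent A ρ)
  × (∀ (ρ : Fin (suc r) → Fin m) → (∀ t → I (ρ t)) → ¬ RowsIndependent A ρ)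

sgn : ℕ → ℤ
sgn zero = + 1
sgn (suc k) = ℤ.- sgn k

det : ∀ k → (Fin k → Fin k → ℤ) → ℤ
det zero    M = + 1
det (suc k) M =
  Σℤ (λ j → sgn (Data.Fin.toℕ j) ℤ.* (M zero j ℤ.*
              det k (λ a b → M (suc a) (punchIn j b))))

IsSubdet : ∀ {m n} → Matrix m n → (Fin m → Set) → ℕ → ℤ → Set
IsSubdet {m} {n} A I k s =
  Σ (Fin k → Fin m) λ ρ → Σ (Fin k → Fin n) λ κ →
    Injective _≡_ _≡_ ρ × Injective _≡_ _≡_ κ × (∀ t → I (ρ t)) ×
    s ≡ det k (λ a b → A (ρ a) (κ b))

GCDSubdetsIsOne : ∀ {m n} → Matrix m n → (Fin m → Set) → ℕ → Set
GCDSubdetsIsOne A I k =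
  ∀ (d : ℤ) → (∀ s → IsSubdet A I k s → d ∣ℤ s) → d ∣ℤ (+ 1)

Cond1 : ∀ {m n} → Matrix m n → IVec m → Set
Cond1 A b = ∀ p → Prime p → TotallyDualPAdic p A b

Cond2 : ∀ {m n} → Matrix m n → IVec m → Set
Cond2 A b = Σ ℕ λ p → Σ ℕ λ q → Prime p × Prime q × p ≢ q ×
              TotallyDualPAdic p A b × TotallyDualPAdic q A b

Cond3 : ∀ {m n} → Matrix m n → IVec m → Set
Cond3 A b = ∀ c δ → NonemptyFace A b c δ →
              ∀ r → IsRankOf A (ImplicitEq A b c δ) r →
                GCDSubdetsIsOne A (ImplicitEq A b c δ) r

module Submission where

-- (1) ⇒ (2) is trivial.
--
-- (2) ⇒ (3): Let L be the lattice spanned by the implicit equality rows of a face.  If an integer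
-- vector w lies in the rational span of L, then for a large enough N the vector w + N Σ A_i has an
-- optimal dual solution supported on these rows; a p-adic one is supported on them as well, by
-- complementary slackness, so p^k w ∈ L, and likewise q^l w ∈ L.  Hence L is saturated.  A saturated
-- lattice contains vectors v_a paired unimodularly with integer functionals φ_b, and det (φ_b v_a) = 1
-- is an integer combination of the minors of the implicit equality rows.
--
-- (3) ⇒ (1): Strict complementarity yields an optimal dual solution N / D whose support is exactly the
-- set of implicit equalities of the primal optimal face.  By Cramer's rule each minor s of maximal order
-- satisfies s w ∈ L, so w ∈ L when the minors have gcd 1, which gives an integral solution z of Aᵀ z = w
-- on the same support.  The points of the line through z and N / D with p-adic parameter are p-adic and
-- dense, so one of them is close enough to N / D to be nonnegative.

open import Defs
open import Data.Bool using (if_then_else_)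
open import Data.Empty using (⊥-elim)
open import Data.Fin as Fin using (Fin; zero; suc; punchIn; punchOut; toℕ; fromℕ<)
open import Data.Fin.Properties
  using (suc-injective; punchIn-punchOut; any?; all?; toℕ-fromℕ<; toℕ<n; toℕ-injective)
  renaming (_≟_ to _≟ᶠ_)
open import Data.Integer as ℤ
  using (ℤ; -[1+_]; _+_; _*_; -_; _-_; 0ℤ; 1ℤ; ∣_∣; _≤_; _<_; +≤+; +<+; _≟_; _≤?_)
  renaming (+_ to pos)
open import Data.Integer.Divisibility using () renaming (_∣_ to _∣ᵤ_)
open import Data.Integer.Divisibility.Signed as ∣ₚ using (_∣_; divides; ∣ᵤ⇒∣; ∣⇒∣ᵤ)
import Data.Integer.Properties as ℤₚ
open import Data.Integer.Tactic.RingSolver using (solve-∀)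
open import Data.Nat as ℕ using (ℕ; zero; suc)
open import Data.Nat.Coprimality as Coprime using (Coprime)
import Data.Nat.Divisibility as ℕᵈ
open import Data.Nat.DivMod using (m≡m%n+[m/n]*n; m%n<n; m*n/n≡m; /-monoˡ-≤)
open import Data.Nat.GCD using (module Bézout; module GCD)
open import Data.Nat.Primality
  using (Prime; prime?; prime[2]; prime⇒irreducible; prime⇒nonTrivial; prime⇒nonZero)
import Data.Nat.Properties as ℕₚ
open import Data.Product using (Σ; ∃; _×_; _,_; proj₁; proj₂)
open import Data.Rational as ℚ using (ℚ; 0ℚ; mkℚ; toℚᵘ; fromℚᵘ)
import Data.Rational.Properties as ℚₚ
open import Data.Rational.Unnormalised as ℚᵘ using (mkℚᵘ; *≡*; *≤*)
import Data.Rational.Unnormalised.Properties as ℚᵘₚ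
open import Data.Sum as Sum using (_⊎_; inj₁; inj₂; [_,_]′)
open import Data.Unit using (⊤; tt)
open import Data.Vec.Functional using (_∷_; updateAt)
open import Data.Vec.Functional.Properties using (updateAt-updates; updateAt-minimal)
open import Function using (_∘_; const; id)
open import Function.Bundles using (_⇔_; mk⇔)
open import Function.Definitions using (Injective)
open import Relation.Binary.PropositionalEquality
  using (_≡_; _≢_; refl; sym; trans; cong; cong₂; cong-app; subst; module ≡-Reasoning)
open import Relation.Nullary using (¬_; Dec; yes; no; does)
open import Relation.Nullary.Decidable using (decidable-stable; from-yes; ¬?; _×-dec_)

-- Both nontrivial directions ask whether one ideal contains 1, namely that of all integers e with e
-- w ∈ L. In (2) ⇒ (3) it contains the coprime numbers p^k and q^l; in (3) ⇒ (1) it contains every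
-- minor of maximal order. The obstacle is constructive. Being an implicit equality quantifies over
-- all rational points of a face, yet (3) yields something only once a rank of these rows has been
-- exhibited, which requires deciding which rows they are. Strict complementarity settles this: for
-- each row there is either an optimal dual solution positive there or an optimal primal point at
-- which the row is slack. It also leaves room for rounding: z may have negative entries, but only
-- where N is positive. Farkas' lemma over ℤ, with denominators cleared, is the only theorem of the
-- alternative: it supplies separation from a span, attainment of the primal optimum and strict
-- complementarity.

Σℤ-cong : ∀ {k} {f g : Fin k → ℤ} → (∀ i → f i ≡ g i) → Σℤ f ≡ Σℤ g
Σℤ-cong {zero}  f≗g = refl
Σℤ-cong {suc k} f≗g = cong₂ _+_ (f≗g zero) (Σℤ-cong (f≗g ∘ suc))

Σℤ-zero : ∀ {k} {f : Fin k → ℤ} → (∀ i → f i ≡ 0ℤ) → Σℤ f ≡ 0ℤ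
Σℤ-zero {zero}  f≗0 = refl
Σℤ-zero {suc k} f≗0 = cong₂ _+_ (f≗0 zero) (Σℤ-zero (f≗0 ∘ suc))

+-interchange : ∀ a b c d → (a + b) + (c + d) ≡ (a + c) + (b + d)
+-interchange = solve-∀

Σℤ-+ : ∀ {k} (f g : Fin k → ℤ) → Σℤ (λ i → f i + g i) ≡ Σℤ f + Σℤ g
Σℤ-+ {zero}  f g = refl
Σℤ-+ {suc k} f g =
  trans (cong ((f zero + g zero) +_) (Σℤ-+ (f ∘ suc) (g ∘ suc)))
        (+-interchange (f zero) (g zero) _ _)

Σℤ-*ˡ : ∀ {k} c (f : Fin k → ℤ) → Σℤ (λ i → c * f i) ≡ c * Σℤ f
Σℤ-*ˡ {zero}  c f = sym (ℤₚ.*-zeroʳ c)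
Σℤ-*ˡ {suc k} c f =
  trans (cong (c * f zero +_) (Σℤ-*ˡ c (f ∘ suc))) (sym (ℤₚ.*-distribˡ-+ c _ _))

Σℤ-*ʳ : ∀ {k} c (f : Fin k → ℤ) → Σℤ (λ i → f i * c) ≡ Σℤ f * c
Σℤ-*ʳ c f = trans (Σℤ-cong (λ i → ℤₚ.*-comm (f i) c)) (trans (Σℤ-*ˡ c f) (ℤₚ.*-comm c _))

Σℤ-swap : ∀ {k l} (f : Fin k → Fin l → ℤ) →
          Σℤ (λ i → Σℤ (f i)) ≡ Σℤ (λ j → Σℤ (λ i → f i j))
Σℤ-swap {zero} {l} f = sym (Σℤ-zero {l} (λ _ → refl))
Σℤ-swap {suc k} f =
  trans (cong (Σℤ (f zero) +_) (Σℤ-swap (f ∘ suc))) (sym (Σℤ-+ (f zero) _))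

Σℤ-single : ∀ {k} (f : Fin k → ℤ) i → (∀ j → j ≢ i → f j ≡ 0ℤ) → Σℤ f ≡ f i
Σℤ-single f zero    off =
  trans (cong (f zero +_) (Σℤ-zero (λ j → off (suc j) λ ()))) (ℤₚ.+-identityʳ _)
Σℤ-single f (suc i) off =
  trans (cong₂ _+_ (off zero λ ())
          (Σℤ-single (f ∘ suc) i (λ j j≢i → off (suc j) (j≢i ∘ suc-injective))))
        (ℤₚ.+-identityˡ _)

-- Determinants: multilinearity, alternation, transposition

det-cong : ∀ k {M N : Fin k → Fin k → ℤ} → (∀ a b → M a b ≡ N a b) → det k M ≡ det k N
det-cong zero    M≗N = refl
det-cong (suc k) M≗N = Σℤ-cong (λ j → cong (sgn (toℕ j) *_)
  (cong₂ _*_ (M≗N zero j) (det-cong k (λ a b → M≗N (suc a) (punchIn j b)))))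

-- Linearity in one argument is phrased for M and Nᵢ that agree off row a, so that no
-- equality between functions and no explicit row replacement is needed.
MultiLinear : ∀ {k l} → ((Fin k → Fin l → ℤ) → ℤ) → Set
MultiLinear {k} {l} f = ∀ a {s} (c : Fin s → ℤ) (M : Fin k → Fin l → ℤ) (N : Fin s → Fin k → Fin l → ℤ) →
  (∀ i b → b ≢ a → ∀ j → N i b j ≡ M b j) →
  (∀ j → M a j ≡ Σℤ (λ i → c i * N i a j)) →
  f M ≡ Σℤ (λ i → c i * f (N i))

det-multilinear : ∀ k → MultiLinear (det k)
det-multilinear (suc k) a {s} c M N off on = begin
    Σℤ (term M)
  ≡⟨ Σℤ-cong (λ j → trans (linear a off on j) (sym (Σℤ-*ˡ (sgn (toℕ j)) (λ i → c i * (N i zero j * minor (N i) j))))) ⟩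
    Σℤ (λ j → Σℤ (λ i → sgn (toℕ j) * (c i * (N i zero j * minor (N i) j))))
  ≡⟨ Σℤ-swap (λ j i → sgn (toℕ j) * (c i * (N i zero j * minor (N i) j))) ⟩
    Σℤ (λ i → Σℤ (λ j → sgn (toℕ j) * (c i * (N i zero j * minor (N i) j))))
  ≡⟨ Σℤ-cong (λ i → trans (Σℤ-cong (λ j → left-comm (sgn (toℕ j)) (c i) (N i zero j * minor (N i) j))) (Σℤ-*ˡ (c i) (term (N i)))) ⟩
    Σℤ (λ i → c i * det (suc k) (N i)) ∎
  where
  open ≡-Reasoning
  minor : (Fin (suc k) → Fin (suc k) → ℤ) → Fin (suc k) → ℤ
  minor M j = det k (λ a b → M (suc a) (punchIn j b))
  term : (Fin (suc k) → Fin (suc k) → ℤ) → Fin (suc k) → ℤ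
  term M j = sgn (toℕ j) * (M zero j * minor M j)
  left-comm : ∀ x y z → x * (y * z) ≡ y * (x * z)
  left-comm = solve-∀
  linear : ∀ a → (∀ i b → b ≢ a → ∀ j → N i b j ≡ M b j) → (∀ j → M a j ≡ Σℤ (λ i → c i * N i a j)) →
           ∀ j → term M j ≡ sgn (toℕ j) * Σℤ (λ i → c i * (N i zero j * minor (N i) j))
  linear zero off on j = cong (sgn (toℕ j) *_) (begin
      M zero j * minor M j
    ≡⟨ cong (_* minor M j) (on j) ⟩
      Σℤ (λ i → c i * N i zero j) * minor M j
    ≡⟨ Σℤ-*ʳ (minor M j) (λ i → c i * N i zero j) ⟨
      Σℤ (λ i → c i * N i zero j * minor M j)
    ≡⟨ Σℤ-cong (λ i → trans (ℤₚ.*-assoc (c i) (N i zero j) (minor M j)) (cong (λ z → c i * (N i zero j * z))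
         (det-cong k (λ a b → sym (off i (suc a) (λ ()) (punchIn j b)))))) ⟩
      Σℤ (λ i → c i * (N i zero j * minor (N i) j)) ∎)
  linear (suc a) off on j = cong (sgn (toℕ j) *_) (begin
      M zero j * minor M j
    ≡⟨ cong (M zero j *_) (det-multilinear k a c (λ a b → M (suc a) (punchIn j b)) (λ i a b → N i (suc a) (punchIn j b))
         (λ i b b≢a _ → off i (suc b) (b≢a ∘ suc-injective) _) (λ _ → on _)) ⟩
      M zero j * Σℤ (λ i → c i * minor (N i) j)
    ≡⟨ Σℤ-*ˡ (M zero j) (λ i → c i * minor (N i) j) ⟨
      Σℤ (λ i → M zero j * (c i * minor (N i) j))
    ≡⟨ Σℤ-cong (λ i → trans (left-comm (M zero j) (c i) (minor (N i) j))
         (cong (λ z → c i * (z * minor (N i) j)) (sym (off i zero (λ ()) j)))) ⟩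
      Σℤ (λ i → c i * (N i zero j * minor (N i) j)) ∎)

-- The Laplace expansion along two equal rows x: the terms of (j , l) and (l , j) cancel.
laplace₂ : ∀ k → (Fin (suc (suc k)) → ℤ) → ((Fin k → Fin (suc (suc k))) → ℤ) → ℤ
laplace₂ k x Φ = Σℤ (λ j → sgn (toℕ j) * (x j * Σℤ (λ b → sgn (toℕ b) *
  (x (punchIn j b) * Φ (λ c → punchIn j (punchIn b c))))))

-- The inner sum for the outer index `suc j` without its first term, the one that picks column
-- `zero`.
laplace₂-tail : ∀ k → (Fin (suc (suc k)) → ℤ) → ((Fin k → Fin (suc (suc k))) → ℤ) → Fin (suc k) → ℤ
laplace₂-tail k x Φ j = Σℤ (λ b → - sgn (toℕ b) *
  (x (suc (punchIn j b)) * Φ (λ c → punchIn (suc j) (punchIn (suc b) c))))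

-- A pair of columns containing `zero` occurs twice, with `zero` outer and with `zero` inner, and
-- with opposite signs. Only pairs avoiding `zero` survive.
laplace₂-step : ∀ k x Φ →
  laplace₂ k x Φ ≡ - 1ℤ * Σℤ (λ j → sgn (toℕ j) * (x (suc j) * laplace₂-tail k x Φ j))
laplace₂-step k x Φ = begin
    1ℤ * (x zero * S) + Σℤ (λ j → - sgn (toℕ j) * (x (suc j) * (1ℤ * (x zero * Ψ j) + R j)))
  ≡⟨ cong (1ℤ * (x zero * S) +_) (trans (Σℤ-cong (λ j → split (sgn (toℕ j)) (x (suc j)) (x zero) (Ψ j) (R j)))
       (Σℤ-+ (λ j → - x zero * (sgn (toℕ j) * (x (suc j) * Ψ j))) (λ j → - 1ℤ * (sgn (toℕ j) * (x (suc j) * R j))))) ⟩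
    1ℤ * (x zero * S) + (Σℤ (λ j → - x zero * (sgn (toℕ j) * (x (suc j) * Ψ j)))
                         + Σℤ (λ j → - 1ℤ * (sgn (toℕ j) * (x (suc j) * R j))))
  ≡⟨ cong₂ (λ u v → 1ℤ * (x zero * S) + (u + v)) (Σℤ-*ˡ (- x zero) (λ j → sgn (toℕ j) * (x (suc j) * Ψ j)))
       (Σℤ-*ˡ (- 1ℤ) (λ j → sgn (toℕ j) * (x (suc j) * R j))) ⟩
    1ℤ * (x zero * S) + (- x zero * S + - 1ℤ * Σℤ (λ j → sgn (toℕ j) * (x (suc j) * R j)))
  ≡⟨ cancel (x zero) S _ ⟩
    - 1ℤ * Σℤ (λ j → sgn (toℕ j) * (x (suc j) * R j)) ∎
  where
  open ≡-Reasoning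
  Ψ R : Fin (suc k) → ℤ
  Ψ b = Φ (λ c → suc (punchIn b c))
  R = laplace₂-tail k x Φ
  S : ℤ
  S = Σℤ (λ b → sgn (toℕ b) * (x (suc b) * Ψ b))
  cancel : ∀ x s t → 1ℤ * (x * s) + (- x * s + t) ≡ t
  cancel = solve-∀
  split : ∀ s y x p r → - s * (y * (1ℤ * (x * p) + r)) ≡ - x * (s * (y * p)) + - 1ℤ * (s * (y * r))
  split = solve-∀

-- After `laplace₂-step` column `zero` is always among the columns left for `Φ`, so it can be
-- absorbed into `Φ′`; what remains is the same sum on one column fewer.
laplace₂≡0 : ∀ k x Φ → (∀ {g h} → (∀ i → g i ≡ h i) → Φ g ≡ Φ h) → laplace₂ k x Φ ≡ 0ℤ
laplace₂≡0 zero x Φ Φ-cong = trans (laplace₂-step zero x Φ)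
  (cong (- 1ℤ *_) (Σℤ-zero (λ j → trans (cong (sgn (toℕ j) *_) (ℤₚ.*-zeroʳ (x (suc j)))) (ℤₚ.*-zeroʳ (sgn (toℕ j))))))
laplace₂≡0 (suc k) x Φ Φ-cong = trans (laplace₂-step (suc k) x Φ)
  (cong (- 1ℤ *_) (trans
    (Σℤ-cong (λ j → trans (cong (λ z → sgn (toℕ j) * (x (suc j) * z)) (tail≡ j)) (pull (sgn (toℕ j)) (x (suc j)) (D j))))
    (trans (Σℤ-*ˡ (- 1ℤ) (λ j → sgn (toℕ j) * (x (suc j) * D j)))
      (cong (- 1ℤ *_) (laplace₂≡0 k (x ∘ suc) Φ′
        (λ g≗h → Φ-cong (λ { zero → refl ; (suc c) → cong suc (g≗h c) })))))))
  where
  Φ′ : (Fin k → Fin (suc (suc k))) → ℤ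
  Φ′ g = Φ (zero ∷ (suc ∘ g))
  D : Fin (suc (suc k)) → ℤ
  D j = Σℤ (λ b → sgn (toℕ b) * (x (suc (punchIn j b)) * Φ′ (λ c → punchIn j (punchIn b c))))
  neg : ∀ s y → - s * y ≡ - 1ℤ * (s * y)
  neg = solve-∀
  pull : ∀ s x p → s * (x * (- 1ℤ * p)) ≡ - 1ℤ * (s * (x * p))
  pull = solve-∀
  tail≡ : ∀ j → laplace₂-tail (suc k) x Φ j ≡ - 1ℤ * D j
  tail≡ j = trans (Σℤ-cong (λ b → trans (neg (sgn (toℕ b)) (x (suc (punchIn j b)) * Φ (λ c → punchIn (suc j) (punchIn (suc b) c))))
      (cong (λ z → - 1ℤ * (sgn (toℕ b) * (x (suc (punchIn j b)) * z)))
        (Φ-cong {λ c → punchIn (suc j) (punchIn (suc b) c)} {zero ∷ (λ c → suc (punchIn j (punchIn b c)))}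
          (λ { zero → refl ; (suc c) → refl })))))
    (Σℤ-*ˡ (- 1ℤ) (λ b → sgn (toℕ b) * (x (suc (punchIn j b)) * Φ′ (λ c → punchIn j (punchIn b c)))))

setRow : ∀ {k} {A : Set} → Fin k → A → (Fin k → A) → Fin k → A
setRow a v M = updateAt M a (const v)

setRow-at : ∀ {k} {A : Set} (a : Fin k) (v : A) M → setRow a v M a ≡ v
setRow-at a v M = updateAt-updates a M

setRow-off : ∀ {k} {A : Set} {a b : Fin k} (v : A) M → b ≢ a → setRow a v M b ≡ M b
setRow-off {a = a} {b} v M b≢a = updateAt-minimal b a M b≢a

KillsEqualRows : ∀ {k l} → ((Fin k → Fin l → ℤ) → ℤ) → Fin k → Fin k → Set
KillsEqualRows {k} {l} f a b = ∀ (M : Fin k → Fin l → ℤ) → (∀ j → M a j ≡ M b j) → f M ≡ 0ℤ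

-- With rows (a , c , b) = (v , w , v), replace rows c and b by w + v.
killsEqualRows-trans : ∀ {k l} {f : (Fin k → Fin l → ℤ) → ℤ} → MultiLinear f →
  ∀ {a b c} → a ≢ c → b ≢ c → a ≢ b → KillsEqualRows f a c → KillsEqualRows f c b → KillsEqualRows f a b
killsEqualRows-trans {k} {l} {f} lin {a} {b} {c} a≢c b≢c a≢b killac killcb M Ma≗Mb = begin
    f M
  ≡⟨ expand (f (row-w M)) (f M) (f M₁) ⟩
    ((1ℤ * (1ℤ * f (row-w M) + (1ℤ * f M + 0ℤ)) + (1ℤ * f M₁ + 0ℤ)) - f (row-w M)) - f M₁
  ≡⟨ cong (λ z → ((1ℤ * z + (1ℤ * f M₁ + 0ℤ)) - f (row-w M)) - f M₁) linear-b ⟨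
    ((1ℤ * f M₀ + (1ℤ * f M₁ + 0ℤ)) - f (row-w M)) - f M₁
  ≡⟨ cong (λ z → (z - f (row-w M)) - f M₁) linear-c ⟨
    (f M₂ - f (row-w M)) - f M₁
  ≡⟨ cong₂ _-_ (cong₂ _-_ (killcb M₂ λ j → trans (cong-app M₂c j) (sym (cong-app (trans (setRow-off _ M₀ b≢c) M₀b) j)))
                          (killcb (row-w M) λ j → trans (cong-app (setRow-off _ M c≢b) j) (sym (cong-app (setRow-at b _ M) j))))
       (killac M₁ λ j → trans (cong-app (trans (setRow-off _ M₀ a≢c) (setRow-off _ M a≢b)) j) (sym (cong-app (setRow-at c _ M₀) j))) ⟩
    0ℤ ∎
  where
  open ≡-Reasoning
  c≢b : c ≢ b
  c≢b = b≢c ∘ sym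
  expand : ∀ x y z → y ≡ ((1ℤ * (1ℤ * x + (1ℤ * y + 0ℤ)) + (1ℤ * z + 0ℤ)) - x) - z
  expand = solve-∀
  two : ∀ x y → x + y ≡ 1ℤ * x + (1ℤ * y + 0ℤ)
  two = solve-∀
  w+v : Fin l → ℤ
  w+v j = M c j + M a j
  row-w : (Fin k → Fin l → ℤ) → Fin k → Fin l → ℤ
  row-w = setRow b (M c)
  -- As rows (a , c , b): `M₀` is (v , w , w+v), `M₁` is (v , v , w+v), `M₂` is (v , w+v , w+v) and
  -- `row-w M` is (v , w , w). All but `M₀` have two equal rows already dealt with.
  M₀ M₁ M₂ : Fin k → Fin l → ℤ
  M₀ = setRow b w+v M
  M₁ = setRow c (M a) M₀
  M₂ = setRow c w+v M₀
  M₀b : M₀ b ≡ w+v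
  M₀b = setRow-at b w+v M
  M₂c : M₂ c ≡ w+v
  M₂c = setRow-at c w+v M₀
  linear-c : f M₂ ≡ 1ℤ * f M₀ + (1ℤ * f M₁ + 0ℤ)
  linear-c = lin c {2} (λ _ → 1ℤ) M₂ (λ { zero → M₀ ; (suc _) → M₁ })
    (λ { zero d d≢c j → cong-app (sym (setRow-off _ M₀ d≢c)) j
       ; (suc _) d d≢c j → cong-app (trans (setRow-off _ M₀ d≢c) (sym (setRow-off _ M₀ d≢c))) j })
    (λ j → trans (cong-app M₂c j) (trans (two (M c j) (M a j))
       (cong₂ (λ x y → 1ℤ * x + (1ℤ * y + 0ℤ))
         (cong-app (sym (setRow-off _ M c≢b)) j) (cong-app (sym (setRow-at c _ M₀)) j))))
  linear-b : f M₀ ≡ 1ℤ * f (row-w M) + (1ℤ * f M + 0ℤ)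
  linear-b = lin b {2} (λ _ → 1ℤ) M₀ (λ { zero → row-w M ; (suc _) → M })
    (λ { zero d d≢b j → cong-app (trans (setRow-off _ M d≢b) (sym (setRow-off _ M d≢b))) j
       ; (suc _) d d≢b j → cong-app (sym (setRow-off _ M d≢b)) j })
    (λ j → trans (cong-app M₀b j) (trans (two (M c j) (M a j))
       (cong₂ (λ x y → 1ℤ * x + (1ℤ * y + 0ℤ)) (cong-app (sym (setRow-at b _ M)) j) (Ma≗Mb j))))

det-kills-suc : ∀ k {a b : Fin k} → KillsEqualRows (det k) a b → KillsEqualRows (det (suc k)) (suc a) (suc b)
det-kills-suc k kills M Ma≗Mb =
  Σℤ-zero (λ j → trans (cong (λ z → sgn (toℕ j) * (M zero j * z))
      (kills (λ a b → M (suc a) (punchIn j b)) (λ b → Ma≗Mb (punchIn j b))))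
    (trans (cong (sgn (toℕ j) *_) (ℤₚ.*-zeroʳ (M zero j))) (ℤₚ.*-zeroʳ (sgn (toℕ j)))))

det-kills-01 : ∀ k → KillsEqualRows (det (suc (suc k))) zero (suc zero)
det-kills-01 k M M0≗M1 =
  trans (Σℤ-cong (λ j → cong (λ z → sgn (toℕ j) * (M zero j * z)) (Σℤ-cong (λ b →
      cong (λ z → sgn (toℕ b) * (z * Φ (λ c → punchIn j (punchIn b c)))) (sym (M0≗M1 (punchIn j b)))))))
    (laplace₂≡0 k (M zero) Φ (λ g≗h → det-cong k (λ a c → cong (M (suc (suc a))) (g≗h c))))
  where
  Φ : (Fin k → Fin (suc (suc k))) → ℤ
  Φ g = det k (λ a c → M (suc (suc a)) (g c))

-- Row 1 is the intermediary: rows 0 and 1 are covered by the double expansion, and rows 1 and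
-- `suc (suc b)` both survive in every minor along row 0.
det-kills-0 : ∀ k → (∀ {a b} → a ≢ b → KillsEqualRows (det k) a b) → ∀ b → KillsEqualRows (det (suc k)) zero (suc b)
det-kills-0 (suc k) ih zero    = det-kills-01 k
det-kills-0 (suc k) ih (suc b) =
  killsEqualRows-trans (det-multilinear (suc (suc k))) (λ ()) (λ ()) (λ ())
    (det-kills-01 k) (det-kills-suc (suc k) (ih λ ()))

det-alternating : ∀ k {a b : Fin k} → a ≢ b → KillsEqualRows (det k) a b
det-alternating (suc k) {zero}  {zero}  a≢b = ⊥-elim (a≢b refl)
det-alternating (suc k) {zero}  {suc b} a≢b = det-kills-0 k (det-alternating k) b
det-alternating (suc k) {suc a} {zero}  a≢b M Ma≗M0 = det-kills-0 k (det-alternating k) a M (λ j → sym (Ma≗M0 j))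
det-alternating (suc k) {suc a} {suc b} a≢b = det-kills-suc k (det-alternating k (a≢b ∘ cong suc))

_ᵀ : ∀ {k l} {A : Set} → (Fin k → Fin l → A) → Fin l → Fin k → A
(M ᵀ) i j = M j i

-- Expanding along row 0 and then, by the induction hypothesis, along column 0 gives a formula
-- symmetric in rows and columns.
det-transpose-step : ∀ k → (∀ M → det k M ≡ det k (M ᵀ)) → (∀ M → det (suc k) M ≡ det (suc k) (M ᵀ)) →
  ∀ M → det (suc (suc k)) M ≡ det (suc (suc k)) (M ᵀ)
det-transpose-step k ih₀ ih₁ M = begin
    det (suc (suc k)) M
  ≡⟨ expansion M ⟩
    1ℤ * (M zero zero * det (suc k) (λ a b → M (suc a) (suc b))) + Σℤ (λ j → Σℤ (term M j))
  ≡⟨ cong₂ (λ u v → 1ℤ * (M zero zero * u) + v) (ih₁ (λ a b → M (suc a) (suc b)))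
       (trans (Σℤ-swap (term M)) (Σℤ-cong (λ a → Σℤ-cong (λ j → term-sym j a)))) ⟩
    1ℤ * (M zero zero * det (suc k) (λ a b → M (suc b) (suc a))) + Σℤ (λ j → Σℤ (term (M ᵀ) j))
  ≡⟨ expansion (M ᵀ) ⟨
    det (suc (suc k)) (M ᵀ) ∎
  where
  open ≡-Reasoning
  minor₂ : (Fin (suc (suc k)) → Fin (suc (suc k)) → ℤ) → Fin (suc k) → Fin (suc k) → ℤ
  minor₂ M j a = det k (λ a′ b → M (suc (punchIn a a′)) (suc (punchIn j b)))
  term : (Fin (suc (suc k)) → Fin (suc (suc k)) → ℤ) → Fin (suc k) → Fin (suc k) → ℤ
  term M j a = - sgn (toℕ j) * (M zero (suc j) * (sgn (toℕ a) * (M (suc a) zero * minor₂ M j a)))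
  swap : ∀ s x t y d → - s * (x * (t * (y * d))) ≡ - t * (y * (s * (x * d)))
  swap = solve-∀
  term-sym : ∀ j a → term M j a ≡ term (M ᵀ) a j
  term-sym j a = trans (swap (sgn (toℕ j)) (M zero (suc j)) (sgn (toℕ a)) (M (suc a) zero) (minor₂ M j a))
    (cong (λ z → - sgn (toℕ a) * (M (suc a) zero * (sgn (toℕ j) * (M zero (suc j) * z))))
      (ih₀ (λ a′ b → M (suc (punchIn a a′)) (suc (punchIn j b)))))
  expand-minor : ∀ M j → det (suc k) (λ a b → M (suc a) (punchIn (suc j) b)) ≡
                 Σℤ (λ a → sgn (toℕ a) * (M (suc a) zero * minor₂ M j a))
  expand-minor M j = trans (ih₁ (λ a b → M (suc a) (punchIn (suc j) b))) (Σℤ-cong (λ a →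
    cong (λ z → sgn (toℕ a) * (M (suc a) zero * z))
      (sym (ih₀ (λ a′ b → M (suc (punchIn a a′)) (suc (punchIn j b)))))))
  expansion : ∀ M → det (suc (suc k)) M ≡
    1ℤ * (M zero zero * det (suc k) (λ a b → M (suc a) (suc b))) + Σℤ (λ j → Σℤ (term M j))
  expansion M = cong (1ℤ * (M zero zero * det (suc k) (λ a b → M (suc a) (suc b))) +_) (Σℤ-cong (λ j →
    trans (cong (λ z → - sgn (toℕ j) * (M zero (suc j) * z)) (expand-minor M j))
      (trans (cong (- sgn (toℕ j) *_) (sym (Σℤ-*ˡ (M zero (suc j)) (λ a → sgn (toℕ a) * (M (suc a) zero * minor₂ M j a)))))
        (sym (Σℤ-*ˡ (- sgn (toℕ j)) (λ a → M zero (suc j) * (sgn (toℕ a) * (M (suc a) zero * minor₂ M j a))))))))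

det-transpose : ∀ k (M : Fin k → Fin k → ℤ) → det k M ≡ det k (M ᵀ)
det-transpose zero          M = refl
det-transpose (suc zero)    M = refl
det-transpose (suc (suc k)) M = det-transpose-step k (det-transpose k) (det-transpose (suc k)) M

-- Determinants and row lattices

dot : ∀ {n} → (Fin n → ℤ) → (Fin n → ℤ) → ℤ
dot u x = Σℤ (λ j → u j * x j)

comb : ∀ {k n} → (Fin k → Fin n → ℤ) → (Fin k → ℤ) → Fin n → ℤ
comb V c j = dot (λ t → V t j) c

dot-congˡ : ∀ {n} {u v : Fin n → ℤ} x → (∀ j → u j ≡ v j) → dot u x ≡ dot v x
dot-congˡ x u≗v = Σℤ-cong (λ j → cong (_* x j) (u≗v j))

dot-congʳ : ∀ {n} (u : Fin n → ℤ) {x y} → (∀ j → x j ≡ y j) → dot u x ≡ dot u y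
dot-congʳ u x≗y = Σℤ-cong (λ j → cong (u j *_) (x≗y j))

dot-comm : ∀ {n} (u x : Fin n → ℤ) → dot u x ≡ dot x u
dot-comm u x = Σℤ-cong (λ j → ℤₚ.*-comm (u j) (x j))

dot-zeroʳ : ∀ {n} (u : Fin n → ℤ) → dot u (λ _ → 0ℤ) ≡ 0ℤ
dot-zeroʳ u = Σℤ-zero (λ j → ℤₚ.*-zeroʳ (u j))

dot-linearʳ : ∀ {n} (u x y : Fin n → ℤ) a b → dot u (λ j → a * x j + b * y j) ≡ a * dot u x + b * dot u y
dot-linearʳ u x y a b = begin
    Σℤ (λ j → u j * (a * x j + b * y j))
  ≡⟨ Σℤ-cong (λ j → lemma (u j) (x j) (y j) a b) ⟩
    Σℤ (λ j → a * (u j * x j) + b * (u j * y j))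
  ≡⟨ Σℤ-+ (λ j → a * (u j * x j)) (λ j → b * (u j * y j)) ⟩
    Σℤ (λ j → a * (u j * x j)) + Σℤ (λ j → b * (u j * y j))
  ≡⟨ cong₂ _+_ (Σℤ-*ˡ a (λ j → u j * x j)) (Σℤ-*ˡ b (λ j → u j * y j)) ⟩
    a * dot u x + b * dot u y ∎
  where
  open ≡-Reasoning
  lemma : ∀ u x y a b → u * (a * x + b * y) ≡ a * (u * x) + b * (u * y)
  lemma = solve-∀

dot-linearˡ : ∀ {n} (u v x : Fin n → ℤ) a b → dot (λ j → a * u j + b * v j) x ≡ a * dot u x + b * dot v x
dot-linearˡ u v x a b = trans (dot-comm (λ j → a * u j + b * v j) x)
  (trans (dot-linearʳ x u v a b) (cong₂ (λ y z → a * y + b * z) (dot-comm x u) (dot-comm x v)))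

dot-*ʳ : ∀ {n} (u x : Fin n → ℤ) a → dot u (λ j → a * x j) ≡ a * dot u x
dot-*ʳ u x a = trans (Σℤ-cong (λ j → lemma (u j) a (x j))) (Σℤ-*ˡ a (λ j → u j * x j))
  where
  lemma : ∀ u a x → u * (a * x) ≡ a * (u * x)
  lemma = solve-∀

dot-*ˡ : ∀ {n} (u x : Fin n → ℤ) a → dot (λ j → a * u j) x ≡ a * dot u x
dot-*ˡ u x a = trans (Σℤ-cong (λ j → ℤₚ.*-assoc a (u j) (x j))) (Σℤ-*ˡ a (λ j → u j * x j))

-- Adjointness of a matrix and its transpose, by exchanging the two sums; weak duality rests on it.
dot-comb : ∀ {k n} (V : Fin k → Fin n → ℤ) c x → dot (comb V c) x ≡ dot (λ t → dot (V t) x) c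
dot-comb V c x = begin
    Σℤ (λ j → Σℤ (λ t → V t j * c t) * x j)
  ≡⟨ Σℤ-cong (λ j → sym (Σℤ-*ʳ (x j) (λ t → V t j * c t))) ⟩
    Σℤ (λ j → Σℤ (λ t → V t j * c t * x j))
  ≡⟨ Σℤ-swap (λ j t → V t j * c t * x j) ⟩
    Σℤ (λ t → Σℤ (λ j → V t j * c t * x j))
  ≡⟨ Σℤ-cong (λ t → trans (Σℤ-cong (λ j → lemma (V t j) (c t) (x j))) (Σℤ-*ʳ (c t) (λ j → V t j * x j))) ⟩
    Σℤ (λ t → dot (V t) x * c t) ∎
  where
  open ≡-Reasoning
  lemma : ∀ v c x → v * c * x ≡ v * x * c
  lemma = solve-∀

δ : ∀ {n} → Fin n → Fin n → ℤ
δ i j = if does (i ≟ᶠ j) then 1ℤ else 0ℤ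

δ-diag : ∀ {n} (i : Fin n) → δ i i ≡ 1ℤ
δ-diag i with i ≟ᶠ i
... | yes _  = refl
... | no i≢i = ⊥-elim (i≢i refl)

δ-off : ∀ {n} {i j : Fin n} → i ≢ j → δ i j ≡ 0ℤ
δ-off {i = i} {j} i≢j with i ≟ᶠ j
... | yes i≡j = ⊥-elim (i≢j i≡j)
... | no _    = refl

dot-δ : ∀ {n} (i : Fin n) x → dot (δ i) x ≡ x i
dot-δ i x = trans
  (Σℤ-single (λ j → δ i j * x j) i (λ j j≢i → trans (cong (_* x j) (δ-off (j≢i ∘ sym))) (ℤₚ.*-zeroˡ (x j))))
  (trans (cong (_* x i) (δ-diag i)) (ℤₚ.*-identityˡ (x i)))

-- Pushforward of coefficients along `ρ`: where `ρ` repeats an index, they add up.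
push : ∀ {k m} → (Fin k → Fin m) → (Fin k → ℤ) → Fin m → ℤ
push ρ c = comb (δ ∘ ρ) c

comb-push : ∀ {k m n} (A : Fin m → Fin n → ℤ) (ρ : Fin k → Fin m) c j → comb A (push ρ c) j ≡ comb (A ∘ ρ) c j
comb-push A ρ c j = trans (dot-comm (λ i → A i j) (push ρ c))
  (trans (dot-comb (δ ∘ ρ) c (λ i → A i j)) (dot-congˡ c (λ t → dot-δ (ρ t) (λ i → A i j))))

-- The disjunction lets a sum over `z` be treated term by term, by cases.
SupportedOn : ∀ {m} → (Fin m → Set) → (Fin m → ℤ) → Set
SupportedOn I z = ∀ i → z i ≡ 0ℤ ⊎ I i

push-supported : ∀ {k m} {I : Fin m → Set} (ρ : Fin k → Fin m) c → (∀ t → I (ρ t)) → SupportedOn I (push ρ c)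
push-supported {I = I} ρ c ρ∈I i with any? (λ t → ρ t ≟ᶠ i)
... | yes (t , ρt≡i) = inj₂ (subst I ρt≡i (ρ∈I t))
... | no  i∉ρ        = inj₁ (Σℤ-zero (λ t →
  trans (cong (_* c t) (δ-off (λ ρt≡i → i∉ρ (t , ρt≡i)))) (ℤₚ.*-zeroˡ (c t))))

linear-supported : ∀ {m} {I : Fin m → Set} {z z′} a b → SupportedOn I z → SupportedOn I z′ →
                   SupportedOn I (λ i → a * z i + b * z′ i)
linear-supported a b supp supp′ i with supp i | supp′ i
... | inj₂ i∈I | _        = inj₂ i∈I
... | inj₁ _   | inj₂ i∈I = inj₂ i∈I
... | inj₁ z≡0 | inj₁ z′≡0 = inj₁ (trans (cong₂ (λ x y → a * x + b * y) z≡0 z′≡0)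
  (cong₂ _+_ (ℤₚ.*-zeroʳ a) (ℤₚ.*-zeroʳ b)))

RowLattice : ∀ {m n} → (Fin m → Fin n → ℤ) → (Fin m → Set) → (Fin n → ℤ) → Set
RowLattice A I w = Σ _ λ z → SupportedOn I z × (∀ j → w j ≡ comb A z j)

rowLattice-linear : ∀ {m n} {A : Fin m → Fin n → ℤ} {I u v} a b → RowLattice A I u → RowLattice A I v →
                    RowLattice A I (λ j → a * u j + b * v j)
rowLattice-linear {A = A} a b (z , supp , u≗) (z′ , supp′ , v≗) =
  (λ i → a * z i + b * z′ i) , linear-supported a b supp supp′ ,
  λ j → trans (cong₂ (λ x y → a * x + b * y) (u≗ j) (v≗ j)) (sym (dot-linearʳ (λ i → A i j) z z′ a b))

rowLattice-comb : ∀ {k m n} {A : Fin m → Fin n → ℤ} {I} (ρ : Fin k → Fin m) c → (∀ t → I (ρ t)) →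
                  RowLattice A I (comb (A ∘ ρ) c)
rowLattice-comb {A = A} ρ c ρ∈I = push ρ c , push-supported ρ c ρ∈I , λ j → sym (comb-push A ρ c j)

rowLattice-cong : ∀ {m n} {A : Fin m → Fin n → ℤ} {I u v} → (∀ j → u j ≡ v j) → RowLattice A I u → RowLattice A I v
rowLattice-cong u≗v (z , supp , u≗) = z , supp , λ j → trans (sym (u≗v j)) (u≗ j)

∣-Σℤ : ∀ {k d} {f : Fin k → ℤ} → (∀ i → d ∣ f i) → d ∣ Σℤ f
∣-Σℤ {zero}  d∣f = divides 0ℤ refl
∣-Σℤ {suc k} d∣f = ∣ₚ.∣m∣n⇒∣m+n (d∣f zero) (∣-Σℤ (d∣f ∘ suc))

∣0 : ∀ {d} → d ∣ 0ℤ
∣0 = divides 0ℤ refl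

module _ {k m : ℕ} (R : Fin m → Fin k → ℤ) (I : Fin m → Set) {d : ℤ}
         (d∣minors : ∀ (ρ : Fin k → Fin m) → (∀ t → I (ρ t)) → d ∣ det k (R ∘ ρ)) where

  private
    -- Rows of index smaller than `n` are still arbitrary lattice vectors, the others are already
    -- generators. Each step expands row `n - 1` into generators by multilinearity.
    expand : ∀ n M → (∀ a → toℕ a ℕ.< n → RowLattice R I (M a)) →
             (∀ a → n ℕ.≤ toℕ a → ∃ λ i → I i × (∀ j → M a j ≡ R i j)) → d ∣ det k M
    expand zero M low high = subst (d ∣_) (det-cong k (λ a j → sym (proj₂ (proj₂ (high a ℕ.z≤n)) j)))
      (d∣minors (λ a → proj₁ (high a ℕ.z≤n)) (λ a → proj₁ (proj₂ (high a ℕ.z≤n))))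
    expand (suc n) M low high with n ℕ.<? k
    ... | no n≮k = expand n M (λ a a<n → low a (ℕₚ.m<n⇒m<1+n a<n))
                     (λ a n≤a → ⊥-elim (n≮k (ℕₚ.≤-<-trans n≤a (toℕ<n a))))
    ... | yes n<k = subst (d ∣_) (sym detM≡) (∣-Σℤ summand)
      where
      a = fromℕ< n<k
      a≡n : toℕ a ≡ n
      a≡n = toℕ-fromℕ< n<k
      row-a : RowLattice R I (M a)
      row-a = low a (ℕ.s≤s (ℕₚ.≤-reflexive a≡n))
      z = proj₁ row-a
      N : Fin m → Fin k → Fin k → ℤ
      N i = setRow a (R i) M
      detM≡ : det k M ≡ Σℤ (λ i → z i * det k (N i))
      detM≡ = det-multilinear k a z M N (λ i b b≢a → cong-app (setRow-off (R i) M b≢a))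
        (λ j → trans (proj₂ (proj₂ row-a) j) (Σℤ-cong (λ i →
          trans (ℤₚ.*-comm (R i j) (z i)) (cong (z i *_) (cong-app (sym (setRow-at a (R i) M)) j)))))
      summand : ∀ i → d ∣ z i * det k (N i)
      summand i with proj₁ (proj₂ row-a) i
      ... | inj₁ zi≡0 = subst (d ∣_) (sym (trans (cong (_* det k (N i)) zi≡0) (ℤₚ.*-zeroˡ (det k (N i))))) ∣0
      ... | inj₂ i∈I = ∣ₚ.∣n⇒∣m*n (z i) (expand n (N i) low′ high′)
        where
        ≢a : ∀ {b} → toℕ b ≢ n → b ≢ a
        ≢a b≢n refl = b≢n a≡n
        low′ : ∀ b → toℕ b ℕ.< n → RowLattice R I (N i b)
        low′ b b<n = rowLattice-cong {A = R} (cong-app (sym (setRow-off (R i) M (≢a (ℕₚ.<⇒≢ b<n))))) (low b (ℕₚ.m<n⇒m<1+n b<n))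
        high′ : ∀ b → n ℕ.≤ toℕ b → ∃ λ i′ → I i′ × (∀ j → N i b j ≡ R i′ j)
        high′ b n≤b with toℕ b ℕ.≟ n
        ... | yes b≡n with refl ← toℕ-injective {i = b} {a} (trans b≡n (sym a≡n)) = i , i∈I , cong-app (setRow-at a (R i) M)
        ... | no  b≢n with i′ , i′∈I , eq ← high b (ℕₚ.≤∧≢⇒< n≤b (b≢n ∘ sym)) =
          i′ , i′∈I , λ j → trans (cong-app (setRow-off (R i) M (≢a b≢n)) j) (eq j)

  ∣det-rowLattice : ∀ M → (∀ a → RowLattice R I (M a)) → d ∣ det k M
  ∣det-rowLattice M rows = expand k M (λ a _ → rows a) (λ a k≤a → ⊥-elim (ℕₚ.<⇒≱ (toℕ<n a) k≤a))

-- Both sides are the determinant with row `t` replaced by `E v`. Homogeneity gives the left one;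
-- expanding `E v` in the rows of `M` gives the right one, since each term with `u ≢ t` repeats a
-- row.
cramer : ∀ k (M : Fin k → Fin k → ℤ) v c E → (∀ j → E * v j ≡ comb M c j) →
         ∀ t → E * det k (setRow t v M) ≡ det k M * c t
cramer k M v c E Ev≗ t = begin
    E * det k (setRow t v M)
  ≡⟨ ℤₚ.+-identityʳ _ ⟨
    E * det k (setRow t v M) + 0ℤ
  ≡⟨ det-multilinear k t {1} (λ _ → E) M′ (λ _ → setRow t v M)
       (λ _ b b≢t j → cong-app (trans (setRow-off v M b≢t) (sym (setRow-off Ev M b≢t))) j)
       (λ j → trans (cong-app (setRow-at t Ev M) j) (trans (sym (ℤₚ.+-identityʳ (E * v j)))
         (cong (λ z → E * z + 0ℤ) (cong-app (sym (setRow-at t v M)) j)))) ⟨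
    det k M′
  ≡⟨ det-multilinear k t c M′ (λ u → setRow t (M u) M)
       (λ u b b≢t j → cong-app (trans (setRow-off (M u) M b≢t) (sym (setRow-off Ev M b≢t))) j)
       (λ j → trans (cong-app (setRow-at t Ev M) j) (trans (Ev≗ j) (Σℤ-cong (λ u →
         trans (ℤₚ.*-comm (M u j) (c u)) (cong (c u *_) (cong-app (sym (setRow-at t (M u) M)) j)))))) ⟩
    Σℤ (λ u → c u * det k (setRow t (M u) M))
  ≡⟨ Σℤ-single (λ u → c u * det k (setRow t (M u) M)) t (λ u u≢t → trans (cong (c u *_)
       (det-alternating k u≢t (setRow t (M u) M) (λ j → trans (cong-app (setRow-off (M u) M u≢t) j)
          (cong-app (sym (setRow-at t (M u) M)) j)))) (ℤₚ.*-zeroʳ (c u))) ⟩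
    c t * det k (setRow t (M t) M)
  ≡⟨ cong (c t *_) (det-cong k same) ⟩
    c t * det k M
  ≡⟨ ℤₚ.*-comm (c t) (det k M) ⟩
    det k M * c t ∎
  where
  open ≡-Reasoning
  Ev : Fin k → ℤ
  Ev j = E * v j
  M′ : Fin k → Fin k → ℤ
  M′ = setRow t Ev M
  same : ∀ a b → setRow t (M t) M a b ≡ M a b
  same a b with a ≟ᶠ t
  ... | yes refl = cong-app (setRow-at t (M t) M) b
  ... | no  a≢t  = cong-app (setRow-off (M t) M a≢t) b

*-cancel : ∀ {E} → E ≢ 0ℤ → ∀ x y → E * x ≡ E * y → x ≡ y
*-cancel {E} E≢0 x y = ℤₚ.*-cancelˡ-≡ E x y {{ ℤ.≢-nonZero E≢0 }}

*-zero-cancel : ∀ {E x} → E ≢ 0ℤ → E * x ≡ 0ℤ → x ≡ 0ℤ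
*-zero-cancel {E} {x} E≢0 Ex≡0 = *-cancel E≢0 x 0ℤ (trans Ex≡0 (sym (ℤₚ.*-zeroʳ E)))

*-≢0 : ∀ {x y} → x ≢ 0ℤ → y ≢ 0ℤ → x * y ≢ 0ℤ
*-≢0 x≢0 y≢0 xy≡0 = y≢0 (*-zero-cancel x≢0 xy≡0)

LinIndep : ∀ {k n} → (Fin k → Fin n → ℤ) → Set
LinIndep V = ∀ l → (∀ j → comb V l j ≡ 0ℤ) → ∀ t → l t ≡ 0ℤ

module _ {k n} (V : Fin k → Fin n → ℤ) (κ : Fin k → Fin n) where

  submatrix : Fin k → Fin k → ℤ
  submatrix a b = V a (κ b)

  cramer-coeff : (Fin n → ℤ) → Fin k → ℤ
  cramer-coeff w t = det k (setRow t (w ∘ κ) submatrix)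

  -- Multiplying the given relation by the minor turns its coefficients into `E` times Cramer
  -- numerators, so `E` cancels. Any rational relation thus becomes an integral one with the minor
  -- as its only denominator.
  cramer-span : ∀ {E} → E ≢ 0ℤ → ∀ w c → (∀ j → E * w j ≡ comb V c j) →
                ∀ j → det k submatrix * w j ≡ comb V (cramer-coeff w) j
  cramer-span {E} E≢0 w c Ew≗ j = *-cancel E≢0 _ _ (begin
      E * (det k submatrix * w j)
    ≡⟨ left-comm E (det k submatrix) (w j) ⟩
      det k submatrix * (E * w j)
    ≡⟨ cong (det k submatrix *_) (Ew≗ j) ⟩
      det k submatrix * comb V c j
    ≡⟨ dot-*ʳ (λ t → V t j) c (det k submatrix) ⟨
      comb V (λ t → det k submatrix * c t) j
    ≡⟨ dot-congʳ (λ t → V t j) (λ t → sym (cramer k submatrix (w ∘ κ) c E (Ew≗ ∘ κ) t)) ⟩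
      comb V (λ t → E * cramer-coeff w t) j
    ≡⟨ dot-*ʳ (λ t → V t j) (cramer-coeff w) E ⟩
      E * comb V (cramer-coeff w) j ∎)
    where
    open ≡-Reasoning
    left-comm : ∀ x y z → x * (y * z) ≡ y * (x * z)
    left-comm = solve-∀

  det≢0⇒linIndep : det k submatrix ≢ 0ℤ → LinIndep V
  det≢0⇒linIndep s≢0 l Vl≡0 t = *-zero-cancel s≢0 (sym (cramer k submatrix (λ _ → 0ℤ) l 0ℤ (λ b → sym (Vl≡0 (κ b))) t))

-- Fraction-free elimination: `C′` holds the lower rows after clearing column `s` with the pivot
-- `h`. A dependency `μ` among them is scaled by `h`, and the coefficient of row `zero` is chosen to
-- cancel column `s`.
exists-dependency : ∀ r (C : Fin (suc r) → Fin r → ℤ) →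
                    ∃ λ l → (∀ s → comb C l s ≡ 0ℤ) × ∃ λ t → l t ≢ 0ℤ
exists-dependency zero    C = (λ _ → 1ℤ) , (λ ()) , zero , λ ()
exists-dependency (suc r) C with any? (λ s → ¬? (C zero s ≟ 0ℤ))
... | no  C0≡0 = δ zero , (λ s → trans (dot-comm (λ t → C t s) (δ zero)) (trans (dot-δ zero (λ t → C t s))
                   (decidable-stable (C zero s ≟ 0ℤ) (λ C0s≢0 → C0≡0 (s , C0s≢0))))) , zero , λ ()
... | yes (s , h≢0) = l , kills , suc u , *-≢0 h≢0 μu≢0
  where
  h = C zero s
  C′ : Fin (suc r) → Fin r → ℤ
  C′ u b = h * C (suc u) (punchIn s b) + - C zero (punchIn s b) * C (suc u) s
  ih = exists-dependency r C′
  μ = proj₁ ih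
  u = proj₁ (proj₂ (proj₂ ih))
  μu≢0 = proj₂ (proj₂ (proj₂ ih))
  l : Fin (suc (suc r)) → ℤ
  l = (- comb (C ∘ suc) μ s) ∷ (λ t → h * μ t)
  eliminate : ∀ j → comb C l j ≡ h * comb (C ∘ suc) μ j + - C zero j * comb (C ∘ suc) μ s
  eliminate j = trans (cong (C zero j * - comb (C ∘ suc) μ s +_) (dot-*ʳ (λ t → C (suc t) j) μ h))
    (lemma (C zero j) (comb (C ∘ suc) μ s) (h * comb (C ∘ suc) μ j))
    where
    lemma : ∀ x y z → x * - y + z ≡ z + - x * y
    lemma = solve-∀
  kills : ∀ j → comb C l j ≡ 0ℤ
  kills j with s ≟ᶠ j
  ... | yes refl = trans (eliminate s) (lemma h (comb (C ∘ suc) μ s))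
    where
    lemma : ∀ x y → x * y + - x * y ≡ 0ℤ
    lemma = solve-∀
  ... | no s≢j = subst (λ j → comb C l j ≡ 0ℤ) (punchIn-punchOut s≢j)
      (trans (eliminate j′) (trans (sym (dot-linearˡ (λ t → C (suc t) j′) (λ t → C (suc t) s) μ h (- C zero j′)))
        (proj₁ (proj₂ ih) (punchOut s≢j))))
    where j′ = punchIn s (punchOut s≢j)

-- Linear inequalities over ℤ

0≤-* : ∀ {x y} → 0ℤ ≤ x → 0ℤ ≤ y → 0ℤ ≤ x * y
0≤-* (+≤+ {n = x} _) (+≤+ {n = y} _) = subst (0ℤ ≤_) (ℤₚ.pos-* x y) (+≤+ ℕ.z≤n)

0<-* : ∀ {x y} → 0ℤ < x → 0ℤ < y → 0ℤ < x * y
0<-* (+<+ {n = suc x} _) (+<+ {n = suc y} _) = +<+ (ℕ.s≤s ℕ.z≤n)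

0≤-+ : ∀ {x y} → 0ℤ ≤ x → 0ℤ ≤ y → 0ℤ ≤ x + y
0≤-+ = ℤₚ.+-mono-≤

0≤-neg : ∀ {x} → x ≤ 0ℤ → 0ℤ ≤ - x
0≤-neg = ℤₚ.neg-mono-≤

0<⇒≢0 : ∀ {x} → 0ℤ < x → x ≢ 0ℤ
0<⇒≢0 0<x x≡0 = ℤₚ.<⇒≢ 0<x (sym x≡0)

0<-square : ∀ {x} → x ≢ 0ℤ → 0ℤ < x * x
0<-square {pos zero}      x≢0 = ⊥-elim (x≢0 refl)
0<-square {pos (suc x)}   x≢0 = +<+ (ℕ.s≤s ℕ.z≤n)
0<-square { -[1+ x ]} x≢0 = +<+ (ℕ.s≤s ℕ.z≤n)

0≤-Σℤ : ∀ {k} {f : Fin k → ℤ} → (∀ i → 0ℤ ≤ f i) → 0ℤ ≤ Σℤ f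
0≤-Σℤ {zero}  0≤f = ℤₚ.≤-refl
0≤-Σℤ {suc k} 0≤f = 0≤-+ (0≤f zero) (0≤-Σℤ (0≤f ∘ suc))

0≤-dot : ∀ {k} {u x : Fin k → ℤ} → (∀ i → 0ℤ ≤ u i) → (∀ i → 0ℤ ≤ x i) → 0ℤ ≤ dot u x
0≤-dot 0≤u 0≤x = 0≤-Σℤ (λ i → 0≤-* (0≤u i) (0≤x i))

≤-Σℤ : ∀ {k} {f : Fin k → ℤ} → (∀ i → 0ℤ ≤ f i) → ∀ i → f i ≤ Σℤ f
≤-Σℤ {f = f} 0≤f zero    = subst (_≤ Σℤ f) (ℤₚ.+-identityʳ (f zero)) (ℤₚ.+-monoʳ-≤ (f zero) (0≤-Σℤ (0≤f ∘ suc)))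
≤-Σℤ {f = f} 0≤f (suc i) = ℤₚ.≤-trans (≤-Σℤ (0≤f ∘ suc) i)
  (subst (_≤ Σℤ f) (ℤₚ.+-identityˡ (Σℤ (f ∘ suc))) (ℤₚ.+-monoˡ-≤ (Σℤ (f ∘ suc)) (0≤f zero)))

Σℤ≤0⇒≡0 : ∀ {k} {f : Fin k → ℤ} → (∀ i → 0ℤ ≤ f i) → Σℤ f ≤ 0ℤ → ∀ i → f i ≡ 0ℤ
Σℤ≤0⇒≡0 0≤f Σf≤0 i = ℤₚ.≤-antisym (ℤₚ.≤-trans (≤-Σℤ 0≤f i) Σf≤0) (0≤f i)

0≤∣x∣+x : ∀ x → 0ℤ ≤ pos ∣ x ∣ + x
0≤∣x∣+x (pos x)  = +≤+ ℕ.z≤n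
0≤∣x∣+x -[1+ x ] = ℤₚ.≤-reflexive (sym (ℤₚ.+-inverseʳ (pos (suc x))))

0<1+ : ∀ {x} → 0ℤ ≤ x → 0ℤ < 1ℤ + x
0<1+ (+≤+ {n = x} _) = +<+ (ℕ.s≤s ℕ.z≤n)

0≤-δ : ∀ {k} (i j : Fin k) → 0ℤ ≤ δ i j
0≤-δ i j with i ≟ᶠ j
... | yes _ = +≤+ ℕ.z≤n
... | no _  = +≤+ ℕ.z≤n

-- Induction on the number of functionals (Bartl's proof), with all divisions cleared: when the
-- solution x for α₁, α₂, … violates α₀, everything is projected along x onto the kernel of α₀.
farkas : ∀ m {n} (α : Fin m → Fin n → ℤ) (γ : Fin n → ℤ) →
  (∃ λ x → (∀ i → dot (α i) x ≤ 0ℤ) × 0ℤ < dot γ x) ⊎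
  (∃ λ E → ∃ λ c → 0ℤ < E × (∀ i → 0ℤ ≤ c i) × (∀ j → E * γ j ≡ comb α c j))
farkas zero α γ with any? (λ j → ¬? (γ j ≟ 0ℤ))
... | no  γ≡0 = inj₂ (1ℤ , (λ ()) , +<+ (ℕ.s≤s ℕ.z≤n) , (λ ()) ,
  λ j → trans (ℤₚ.*-identityˡ (γ j)) (decidable-stable (γ j ≟ 0ℤ) (λ γj≢0 → γ≡0 (j , γj≢0))))
... | yes (j , γj≢0) = inj₁ ((λ l → γ j * δ j l) , (λ ()) ,
  subst (0ℤ <_) (sym (trans (dot-*ʳ γ (δ j) (γ j)) (cong (γ j *_) (trans (dot-comm γ (δ j)) (dot-δ j γ)))))
    (0<-square γj≢0))
farkas (suc m) {n} α γ with farkas m (α ∘ suc) γ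
... | inj₂ (E , c , 0<E , 0≤c , Eγ≗) = inj₂ (E , 0ℤ ∷ c , 0<E , (λ { zero → ℤₚ.≤-refl ; (suc i) → 0≤c i }) ,
  λ j → trans (Eγ≗ j) (sym (trans (cong (_+ comb (α ∘ suc) c j) (ℤₚ.*-zeroʳ (α zero j))) (ℤₚ.+-identityˡ _))))
... | inj₁ (x , αx≤0 , 0<γx) with dot (α zero) x ≤? 0ℤ
...   | yes α₀x≤0 = inj₁ (x , (λ { zero → α₀x≤0 ; (suc i) → αx≤0 i }) , 0<γx)
...   | no  α₀x≰0 = conclude (farkas m (λ i → project (α (suc i))) (project γ))
  where
  a = α zero
  h = dot a x
  0<h : 0ℤ < h
  0<h = ℤₚ.≰⇒> α₀x≰0
  project : (Fin n → ℤ) → Fin n → ℤ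
  project u j = h * u j + a j * - dot u x
  -- Projecting functionals is adjoint to moving `y` along `x` into the kernel of `a`.
  dot-project : ∀ u y → dot (project u) y ≡ dot u (λ j → h * y j + - dot a y * x j)
  dot-project u y = trans (dot-congˡ y (λ j → cong (h * u j +_) (ℤₚ.*-comm (a j) (- dot u x))))
    (trans (dot-linearˡ u a y h (- dot u x))
      (trans (lemma (h * dot u y) (dot u x) (dot a y)) (sym (dot-linearʳ u y x h (- dot a y)))))
    where
    lemma : ∀ p q r → p + - q * r ≡ p + - r * q
    lemma = solve-∀
  conclude : _ → _
  conclude (inj₁ (y , αy≤0 , 0<γy)) = inj₁ ((λ j → h * y j + - dot a y * x j) ,
      (λ { zero → ℤₚ.≤-reflexive (trans (dot-linearʳ a y x h (- dot a y)) (lemma h (dot a y)))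
         ; (suc i) → subst (_≤ 0ℤ) (dot-project (α (suc i)) y) (αy≤0 i) }) ,
      subst (0ℤ <_) (dot-project γ y) 0<γy)
    where
    lemma : ∀ p q → p * q + - q * p ≡ 0ℤ
    lemma = solve-∀
  conclude (inj₂ (E , c , 0<E , 0≤c , Eγ≗)) = inj₂ (E * h , c₀ ∷ (λ i → h * c i) , 0<-* 0<E 0<h ,
      (λ { zero → 0≤-+ (0≤-* (ℤₚ.<⇒≤ 0<E) (ℤₚ.<⇒≤ 0<γx)) (0≤-dot (λ i → 0≤-neg (αx≤0 i)) 0≤c)
         ; (suc i) → 0≤-* (ℤₚ.<⇒≤ 0<h) (0≤c i) }) , eq)
    where
    open ≡-Reasoning
    αx : Fin m → ℤ
    αx i = - dot (α (suc i)) x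
    -- Undoing the projections leaves multiples of `a`, collected in `c₀`. It is nonnegative because
    -- `γ` is positive at `x` and the later functionals are nonpositive there.
    c₀ = E * dot γ x + dot αx c
    lemma₁ : ∀ E h g a q → E * h * g ≡ E * (h * g + a * - q) + a * (E * q)
    lemma₁ = solve-∀
    lemma₂ : ∀ h p a d e → h * p + a * d + a * e ≡ a * (e + d) + h * p
    lemma₂ = solve-∀
    eq : ∀ j → E * h * γ j ≡ comb α (c₀ ∷ (λ i → h * c i)) j
    eq j = begin
        E * h * γ j
      ≡⟨ lemma₁ E h (γ j) (a j) (dot γ x) ⟩
        E * project γ j + a j * (E * dot γ x)
      ≡⟨ cong (_+ a j * (E * dot γ x)) (trans (Eγ≗ j) (dot-linearˡ (λ i → α (suc i) j) αx c h (a j))) ⟩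
        h * comb (α ∘ suc) c j + a j * dot αx c + a j * (E * dot γ x)
      ≡⟨ lemma₂ h (comb (α ∘ suc) c j) (a j) (dot αx c) (E * dot γ x) ⟩
        a j * c₀ + h * comb (α ∘ suc) c j
      ≡⟨ cong (a j * c₀ +_) (sym (dot-*ʳ (λ i → α (suc i) j) c h)) ⟩
        comb α (c₀ ∷ (λ i → h * c i)) j ∎

RationalSpan : ∀ {k n} → (Fin k → Fin n → ℤ) → (Fin n → ℤ) → Set
RationalSpan V w = ∃ λ E → ∃ λ c → E ≢ 0ℤ × (∀ j → E * w j ≡ comb V c j)

-- The cone generated by V and - Σ V is the whole span of V.
span-or-separate : ∀ {k n} (V : Fin k → Fin n → ℤ) w →
  RationalSpan V w ⊎ ∃ λ x → (∀ t → dot (V t) x ≡ 0ℤ) × dot w x ≢ 0ℤ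
span-or-separate {k} V w with farkas (suc k) (comb V (λ _ → - 1ℤ) ∷ V) w
... | inj₂ (E , c , 0<E , _ , Ew≗) = inj₁ (E , (λ t → c zero * - 1ℤ + 1ℤ * c (suc t)) , 0<⇒≢0 0<E , λ j →
  trans (Ew≗ j) (trans (lemma (comb V (λ _ → - 1ℤ) j) (c zero) (comb V (c ∘ suc) j))
    (sym (dot-linearʳ (λ t → V t j) (λ _ → - 1ℤ) (c ∘ suc) (c zero) 1ℤ))))
  where
  lemma : ∀ p q r → p * q + r ≡ q * p + 1ℤ * r
  lemma = solve-∀
... | inj₁ (x , ≤0 , 0<wx) = inj₂ (x , Vx≡0 , 0<⇒≢0 0<wx)
  where
  Vx≡0 : ∀ t → dot (V t) x ≡ 0ℤ
  Vx≡0 t = trans (lemma (dot (V t) x)) (cong -_ (Σℤ≤0⇒≡0 {f = λ t → dot (V t) x * - 1ℤ}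
      (λ t → subst (0ℤ ≤_) (lemma′ (dot (V t) x)) (0≤-neg (≤0 (suc t))))
      (subst (_≤ 0ℤ) (dot-comb V (λ _ → - 1ℤ) x) (≤0 zero)) t))
    where
    lemma : ∀ p → p ≡ - (p * - 1ℤ)
    lemma = solve-∀
    lemma′ : ∀ p → - p ≡ p * - 1ℤ
    lemma′ = solve-∀

-- Pairing a dependency with `x` isolates the coefficient of `V zero`.
linIndep-∷ : ∀ {k n} (V : Fin (suc k) → Fin n → ℤ) x → dot (V zero) x ≢ 0ℤ → (∀ t → dot (V (suc t)) x ≡ 0ℤ) →
             LinIndep (V ∘ suc) → LinIndep V
linIndep-∷ V x V₀x≢0 Vx≡0 indep l Vl≡0 = λ { zero → l₀≡0 ; (suc t) → indep (l ∘ suc) tail≡0 t }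
  where
  l₀≡0 : l zero ≡ 0ℤ
  l₀≡0 = *-zero-cancel V₀x≢0 (begin
      dot (V zero) x * l zero
    ≡⟨ ℤₚ.+-identityʳ _ ⟨
      dot (V zero) x * l zero + 0ℤ
    ≡⟨ cong (dot (V zero) x * l zero +_) (Σℤ-zero (λ t → trans (cong (_* l (suc t)) (Vx≡0 t)) (ℤₚ.*-zeroˡ (l (suc t))))) ⟨
      dot (λ t → dot (V t) x) l
    ≡⟨ dot-comb V l x ⟨
      dot (comb V l) x
    ≡⟨ Σℤ-zero (λ j → trans (cong (_* x j) (Vl≡0 j)) (ℤₚ.*-zeroˡ (x j))) ⟩
      0ℤ ∎)
    where open ≡-Reasoning
  tail≡0 : ∀ j → comb (V ∘ suc) (l ∘ suc) j ≡ 0ℤ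
  tail≡0 j = trans (sym (ℤₚ.+-identityˡ _)) (trans (cong (_+ comb (V ∘ suc) (l ∘ suc) j)
    (sym (trans (cong (V zero j *_) l₀≡0) (ℤₚ.*-zeroʳ (V zero j))))) (Vl≡0 j))

rationalSpan-tail : ∀ {k n} {V : Fin (suc k) → Fin n → ℤ} {w} → RationalSpan (V ∘ suc) w → RationalSpan V w
rationalSpan-tail {V = V} (E , c , E≢0 , Ew≗) = E , 0ℤ ∷ c , E≢0 , λ j → trans (Ew≗ j)
  (sym (trans (cong (_+ comb (V ∘ suc) c j) (ℤₚ.*-zeroʳ (V zero j))) (ℤₚ.+-identityˡ _)))

-- Greedy choice from the last row upwards: a row is added when some `x` separates it from the span
-- so far, and that `x` certifies independence.
exists-basis : ∀ m {n} (A : Fin m → Fin n → ℤ) (I : Fin m → Set) → (∀ i → Dec (I i)) →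
  ∃ λ r → Σ (Fin r → Fin m) λ ρ →
    (∀ t → I (ρ t)) × LinIndep (A ∘ ρ) × (∀ i → I i → RationalSpan (A ∘ ρ) (A i))
exists-basis zero    A I I? = 0 , (λ ()) , (λ ()) , (λ _ _ ()) , λ ()
exists-basis (suc m) {n} A I I? with exists-basis m (A ∘ suc) (I ∘ suc) (I? ∘ suc) | I? zero
... | r , ρ , ρ∈I , indep , spans | no 0∉I =
  r , suc ∘ ρ , ρ∈I , indep , λ { zero 0∈I → ⊥-elim (0∉I 0∈I) ; (suc i) → spans i }
... | r , ρ , ρ∈I , indep , spans | yes 0∈I with span-or-separate (A ∘ suc ∘ ρ) (A zero)
...   | inj₁ A₀∈span = r , suc ∘ ρ , ρ∈I , indep , λ { zero _ → A₀∈span ; (suc i) → spans i }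
...   | inj₂ (x , Ax≡0 , A₀x≢0) = suc r , ρ⁺ , (λ { zero → 0∈I ; (suc t) → ρ∈I t }) ,
        linIndep-∷ (A ∘ ρ⁺) x A₀x≢0 Ax≡0 indep ,
        λ { zero _ → 1ℤ , (1ℤ ∷ (λ _ → 0ℤ)) , (λ ()) , first
          ; (suc i) i∈I → rationalSpan-tail {V = A ∘ ρ⁺} {A (suc i)} (spans i i∈I) }
  where
  ρ⁺ : Fin (suc r) → Fin (suc m)
  ρ⁺ = zero ∷ (suc ∘ ρ)
  first : ∀ j → 1ℤ * A zero j ≡ A zero j * 1ℤ + comb (A ∘ suc ∘ ρ) (λ _ → 0ℤ) j
  first j = trans (lemma (A zero j)) (cong (A zero j * 1ℤ +_) (sym (dot-zeroʳ (λ t → A (suc (ρ t)) j))))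
    where
    lemma : ∀ p → 1ℤ * p ≡ p * 1ℤ + 0ℤ
    lemma = solve-∀

-- The coefficient vectors of the `U t` are one more than their length, so they are dependent; the
-- factors `E t` carry that dependency over to `U`.
span⇒dependent : ∀ {r n} (V : Fin r → Fin n → ℤ) (U : Fin (suc r) → Fin n → ℤ) →
                 (∀ t → RationalSpan V (U t)) → ¬ LinIndep U
span⇒dependent {r} V U U∈V indep =
  proj₂ t,lt≢0 (*-zero-cancel (proj₁ (proj₂ (proj₂ (U∈V t)))) (indep (λ t → E t * l t) dependent t))
  where
  E : Fin (suc r) → ℤ
  E t = proj₁ (U∈V t)
  C : Fin (suc r) → Fin r → ℤ
  C t = proj₁ (proj₂ (U∈V t))
  l = proj₁ (exists-dependency r C)
  t,lt≢0 = proj₂ (proj₂ (exists-dependency r C))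
  t = proj₁ t,lt≢0
  dependent : ∀ j → comb U (λ t → E t * l t) j ≡ 0ℤ
  dependent j = begin
      Σℤ (λ t → U t j * (E t * l t))
    ≡⟨ Σℤ-cong (λ t → lemma (U t j) (E t) (l t)) ⟩
      dot (λ t → E t * U t j) l
    ≡⟨ dot-congˡ l (λ t → trans (proj₂ (proj₂ (proj₂ (U∈V t))) j) (dot-comm (λ s → V s j) (C t))) ⟩
      dot (λ t → dot (C t) (λ s → V s j)) l
    ≡⟨ dot-comb C l (λ s → V s j) ⟨
      dot (comb C l) (λ s → V s j)
    ≡⟨ Σℤ-zero (λ s → trans (cong (_* V s j) (proj₁ (proj₂ (exists-dependency r C)) s)) (ℤₚ.*-zeroˡ (V s j))) ⟩
      0ℤ ∎
    where
    open ≡-Reasoning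
    lemma : ∀ u e l → u * (e * l) ≡ e * u * l
    lemma = solve-∀

-- Ideals of integers and the gcd of the minors

record IsIdeal (Q : ℤ → Set) : Set where
  field
    zero-mem   : Q 0ℤ
    linear-mem : ∀ {x y} a b → Q x → Q y → Q (a * x + b * y)

unit-abs : ∀ x → ∃ λ s → pos ∣ x ∣ ≡ s * x
unit-abs (pos n)        = 1ℤ , sym (ℤₚ.*-identityˡ (pos n))
unit-abs (-[1+ n ]) = - 1ℤ , sym (ℤₚ.-1*i≡-i -[1+ n ])

module _ {Q : ℤ → Set} (ideal : IsIdeal Q) where
  open IsIdeal ideal

  gcd-mem : ∀ {x y} → Q x → Q y → ∃ λ g → Q g × (g ∣ x) × (g ∣ y)
  gcd-mem {x} {y} Qx Qy with Bézout.lemma ∣ x ∣ ∣ y ∣ | unit-abs x | unit-abs y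
  ... | Bézout.result d g b | s , ∣x∣≡ | t , ∣y∣≡ =
    pos d , Qd b , ∣ᵤ⇒∣ (proj₁ (GCD.commonDivisor g)) , ∣ᵤ⇒∣ (proj₂ (GCD.commonDivisor g))
    where
    combine : ∀ a b m n → pos (d ℕ.+ b ℕ.* n) ≡ pos (a ℕ.* m) → pos d ≡ pos a * pos m - pos b * pos n
    combine a b m n eq = trans (lemma′ (pos d) (pos b * pos n))
      (cong (_- pos b * pos n) (trans (cong (pos d +_) (sym (ℤₚ.pos-* b n))) (trans eq (ℤₚ.pos-* a m))))
      where
      lemma′ : ∀ d u → d ≡ (d + u) - u
      lemma′ = solve-∀
    lemma₁ : ∀ a s x b t y → a * (s * x) - b * (t * y) ≡ a * s * x + - (b * t) * y
    lemma₁ = solve-∀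
    lemma₂ : ∀ a s x b t y → a * (s * x) - b * (t * y) ≡ - (b * t) * y + a * s * x
    lemma₂ = solve-∀
    Qd : Bézout.Identity d ∣ x ∣ ∣ y ∣ → Q (pos d)
    Qd (Bézout.+- a b eq) = subst Q (sym (trans (combine a b ∣ x ∣ ∣ y ∣ (cong pos eq))
      (trans (cong₂ (λ u v → pos a * u - pos b * v) ∣x∣≡ ∣y∣≡) (lemma₁ (pos a) s x (pos b) t y))))
      (linear-mem (pos a * s) (- (pos b * t)) Qx Qy)
    Qd (Bézout.-+ a b eq) = subst Q (sym (trans (combine b a ∣ y ∣ ∣ x ∣ (cong pos eq))
      (trans (cong₂ (λ u v → pos b * v - pos a * u) ∣x∣≡ ∣y∣≡) (lemma₂ (pos b) t y (pos a) s x))))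
      (linear-mem (- (pos a * s)) (pos b * t) Qx Qy)

  -- `R i g` is to be read as: `g` divides everything attached to `i`. It passes to divisors, so the
  -- gcd of the individual members serves all indices at once.
  gcd-mem-Fin : ∀ N (R : Fin N → ℤ → Set) → (∀ i {g g′} → g′ ∣ g → R i g → R i g′) →
    (∀ i → ∃ λ g → Q g × R i g) → ∃ λ g → Q g × (∀ i → R i g)
  gcd-mem-Fin zero    R down has = 0ℤ , zero-mem , λ ()
  gcd-mem-Fin (suc N) R down has with has zero | gcd-mem-Fin N (R ∘ suc) (down ∘ suc) (has ∘ suc)
  ... | g₀ , Qg₀ , R₀ | g₁ , Qg₁ , R₁ with gcd-mem Qg₀ Qg₁
  ...   | g , Qg , g∣g₀ , g∣g₁ = g , Qg , λ { zero → down zero g∣g₀ R₀ ; (suc i) → down (suc i) g∣g₁ (R₁ i) }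

  -- The finitely many index functions are handled one coordinate at a time; `ext` identifies `ρ`
  -- with its head followed by its tail.
  gcd-mem-Fun : ∀ r {N} (R : (Fin r → Fin N) → ℤ → Set) →
    (∀ {ρ ρ′ g} → (∀ t → ρ t ≡ ρ′ t) → R ρ g → R ρ′ g) → (∀ ρ {g g′} → g′ ∣ g → R ρ g → R ρ g′) →
    (∀ ρ → ∃ λ g → Q g × R ρ g) → ∃ λ g → Q g × (∀ ρ → R ρ g)
  gcd-mem-Fun zero    R ext down has with has (λ ())
  ... | g , Qg , Rg = g , Qg , λ ρ → ext (λ ()) Rg
  gcd-mem-Fun (suc r) {N} R ext down has
    with gcd-mem-Fin N (λ i g → ∀ ρ → R (i ∷ ρ) g) (λ i g′∣g Rg ρ → down (i ∷ ρ) g′∣g (Rg ρ))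
           (λ i → gcd-mem-Fun r (λ ρ → R (i ∷ ρ)) (λ ρ≗ → ext (λ { zero → refl ; (suc t) → ρ≗ t }))
                    (λ ρ → down (i ∷ ρ)) (λ ρ → has (i ∷ ρ)))
  ... | g , Qg , Rg = g , Qg , λ ρ → ext (λ { zero → refl ; (suc t) → refl }) (Rg (ρ zero) (ρ ∘ suc))

-- Unlike `GCDSubdetsIsOne`, this admits repeated rows and columns, whose minors vanish and leave
-- the gcd unchanged.
UnitGCDOfMinors : ∀ {m n} → (Fin m → Fin n → ℤ) → (Fin m → Set) → ℕ → Set
UnitGCDOfMinors {m} {n} A I r =
  ∀ d → (∀ (ρ : Fin r → Fin m) (κ : Fin r → Fin n) → (∀ t → I (ρ t)) → d ∣ det r (λ a b → A (ρ a) (κ b))) → d ∣ 1ℤ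

multiplier-ideal : ∀ {m n} (A : Fin m → Fin n → ℤ) (I : Fin m → Set) (w : Fin n → ℤ) → IsIdeal (λ e → RowLattice A I (λ j → e * w j))
multiplier-ideal A I w = record
  { zero-mem = (λ _ → 0ℤ) , (λ _ → inj₁ refl) , λ j → trans (ℤₚ.*-zeroˡ (w j)) (sym (dot-zeroʳ (λ i → A i j)))
  ; linear-mem = λ {x} {y} a b Qx Qy →
      rowLattice-cong {A = A} (λ j → lemma a x b y (w j)) (rowLattice-linear {A = A} a b Qx Qy) }
  where
  lemma : ∀ a x b y w → a * (x * w) + b * (y * w) ≡ (a * x + b * y) * w
  lemma = solve-∀

unit-multiplier : ∀ {m n} (A : Fin m → Fin n → ℤ) (I : Fin m → Set) (w : Fin n → ℤ) {g} → g ∣ 1ℤ → RowLattice A I (λ j → g * w j) → RowLattice A I w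
unit-multiplier A I w {g} (divides q 1≡qg) gw∈L = rowLattice-cong {A = A} w≗ (rowLattice-linear {A = A} q 0ℤ gw∈L gw∈L)
  where
  lemma : ∀ q g w → q * (g * w) + 0ℤ * (g * w) ≡ q * g * w
  lemma = solve-∀
  w≗ : ∀ j → q * (g * w j) + 0ℤ * (g * w j) ≡ w j
  w≗ j = trans (lemma q g (w j)) (trans (cong (_* w j) (sym 1≡qg)) (ℤₚ.*-identityˡ (w j)))

module _ {m n} (A : Fin m → Fin n → ℤ) (I : Fin m → Set) (I? : ∀ i → Dec (I i)) {r}
  (maximal : ∀ (τ : Fin (suc r) → Fin m) → (∀ t → I (τ t)) → ¬ LinIndep (A ∘ τ)) where

  -- Maximality only refutes independence and provides no coefficients. Equality of integers is
  -- decidable, so one may argue by contradiction: if the identity failed, Cramer's rule would force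
  -- `l zero` to be 0 in every dependency of `i ∷ ρ`, and the nonzero minor would force the rest.
  minor-span : ∀ (ρ : Fin r → Fin m) (κ : Fin r → Fin n) → (∀ t → I (ρ t)) → det r (submatrix (A ∘ ρ) κ) ≢ 0ℤ →
    ∀ i → I i → ∀ j → det r (submatrix (A ∘ ρ) κ) * A i j ≡ comb (A ∘ ρ) (cramer-coeff (A ∘ ρ) κ (A i)) j
  minor-span ρ κ ρ∈I s≢0 i i∈I j = decidable-stable (_ ≟ _)
    (λ s*Aij≢ → maximal (i ∷ ρ) (λ { zero → i∈I ; (suc t) → ρ∈I t }) (indep s*Aij≢))
    where
    s = det r (submatrix (A ∘ ρ) κ)
    indep : s * A i j ≢ comb (A ∘ ρ) (cramer-coeff (A ∘ ρ) κ (A i)) j → LinIndep (A ∘ (i ∷ ρ))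
    indep s*Aij≢ l Vl≡0 = λ { zero → l₀≡0 ; (suc t) → det≢0⇒linIndep (A ∘ ρ) κ s≢0 (l ∘ suc) tail≡0 t }
      where
      l₀≡0 : l zero ≡ 0ℤ
      l₀≡0 = decidable-stable (l zero ≟ 0ℤ) (λ l₀≢0 → s*Aij≢ (cramer-span (A ∘ ρ) κ l₀≢0 (A i) (λ t → - 1ℤ * l (suc t))
        (λ j → trans (lemma (l zero) (A i j) (comb (A ∘ ρ) (l ∘ suc) j)) (trans (cong (_+ - 1ℤ * comb (A ∘ ρ) (l ∘ suc) j) (Vl≡0 j))
          (trans (ℤₚ.+-identityˡ _) (sym (dot-*ʳ (λ t → A (ρ t) j) (l ∘ suc) (- 1ℤ)))))) j))
        where
        lemma : ∀ l a c → l * a ≡ (a * l + c) + - 1ℤ * c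
        lemma = solve-∀
      tail≡0 : ∀ j → comb (A ∘ ρ) (l ∘ suc) j ≡ 0ℤ
      tail≡0 j = trans (sym (ℤₚ.+-identityˡ _)) (trans (cong (_+ comb (A ∘ ρ) (l ∘ suc) j)
        (sym (trans (cong (A i j *_) l₀≡0) (ℤₚ.*-zeroʳ (A i j))))) (Vl≡0 j))

  module _ {D} (D≢0 : D ≢ 0ℤ) (w : Fin n → ℤ) (N : Fin m → ℤ) (N∈I : SupportedOn I N)
           (Dw≗ : ∀ j → D * w j ≡ comb A N j) where

    -- By `minor-span`, `s * D * w` is an integer combination of the rows `ρ`. Cramer's rule on the
    -- same columns trades the factor `s * D` for `s` alone.
    minor-multiple : ∀ (ρ : Fin r → Fin m) (κ : Fin r → Fin n) → (∀ t → I (ρ t)) →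
                     RowLattice A I (λ j → det r (submatrix (A ∘ ρ) κ) * w j)
    minor-multiple ρ κ ρ∈I with det r (submatrix (A ∘ ρ) κ) ≟ 0ℤ
    ... | yes s≡0 = (λ _ → 0ℤ) , (λ _ → inj₁ refl) , λ j →
      trans (trans (cong (_* w j) s≡0) (ℤₚ.*-zeroˡ (w j))) (sym (dot-zeroʳ (λ i → A i j)))
    ... | no  s≢0 = rowLattice-cong {A = A} (λ j → sym (cramer-span (A ∘ ρ) κ (*-≢0 s≢0 D≢0) w c span j))
                      (rowLattice-comb {A = A} ρ (cramer-coeff (A ∘ ρ) κ w) ρ∈I)
      where
      open ≡-Reasoning
      s = det r (submatrix (A ∘ ρ) κ)
      coeff : Fin m → Fin r → ℤ
      coeff i = cramer-coeff (A ∘ ρ) κ (A i)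
      c : Fin r → ℤ
      c = comb coeff N
      lemma : ∀ s a n → s * (a * n) ≡ s * a * n
      lemma = solve-∀
      summand : ∀ i j → s * (A i j * N i) ≡ dot (coeff i) (λ t → A (ρ t) j) * N i
      summand i j with N∈I i
      ... | inj₁ Ni≡0 = trans (cong (λ z → s * (A i j * z)) Ni≡0) (trans (trans (cong (s *_) (ℤₚ.*-zeroʳ (A i j))) (ℤₚ.*-zeroʳ s))
        (sym (trans (cong (dot (coeff i) (λ t → A (ρ t) j) *_) Ni≡0) (ℤₚ.*-zeroʳ (dot (coeff i) (λ t → A (ρ t) j))))))
      ... | inj₂ i∈I = trans (lemma s (A i j) (N i)) (cong (_* N i)
        (trans (minor-span ρ κ ρ∈I s≢0 i i∈I j) (dot-comm (λ t → A (ρ t) j) (coeff i))))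
      span : ∀ j → s * D * w j ≡ comb (A ∘ ρ) c j
      span j = begin
          s * D * w j
        ≡⟨ trans (ℤₚ.*-assoc s D (w j)) (cong (s *_) (Dw≗ j)) ⟩
          s * comb A N j
        ≡⟨ Σℤ-*ˡ s (λ i → A i j * N i) ⟨
          Σℤ (λ i → s * (A i j * N i))
        ≡⟨ Σℤ-cong (λ i → summand i j) ⟩
          dot (λ i → dot (coeff i) (λ t → A (ρ t) j)) N
        ≡⟨ dot-comb coeff N (λ t → A (ρ t) j) ⟨
          dot c (λ t → A (ρ t) j)
        ≡⟨ dot-comm c (λ t → A (ρ t) j) ⟩
          comb (A ∘ ρ) c j ∎

    -- All minors lie in the ideal of multipliers of `w`, hence so does their gcd. Deciding `I`
    -- sorts out the row choices that leave it; for those the member 0 will do.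
    unit-gcd⇒rowLattice : UnitGCDOfMinors A I r → RowLattice A I w
    unit-gcd⇒rowLattice unit = unit-multiplier A I w g∣1 Qg
      where
      Q : ℤ → Set
      Q e = RowLattice A I (λ j → e * w j)
      ideal : IsIdeal Q
      ideal = multiplier-ideal A I w
      minor : (Fin r → Fin m) → (Fin r → Fin n) → ℤ
      minor ρ κ = det r (submatrix (A ∘ ρ) κ)
      dividesAll : (Fin r → Fin m) → ℤ → Set
      dividesAll ρ g = (∀ t → I (ρ t)) → ∀ κ → g ∣ minor ρ κ
      has : ∀ ρ → ∃ λ g → Q g × dividesAll ρ g
      has ρ with all? (I? ∘ ρ)
      ... | no  ρ∉I = 0ℤ , IsIdeal.zero-mem ideal , λ ρ∈I → ⊥-elim (ρ∉I ρ∈I)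
      ... | yes ρ∈I with gcd-mem-Fun ideal r (λ κ g → g ∣ minor ρ κ)
                           (λ {κ} {κ′} {g} κ≗ → subst (g ∣_) (det-cong r (λ a b → cong (A (ρ a)) (κ≗ b))))
                           (λ κ → ∣ₚ.∣-trans) (λ κ → minor ρ κ , minor-multiple ρ κ ρ∈I , ∣ₚ.∣-refl)
      ...   | g , Qg , g∣ = g , Qg , λ _ → g∣
      common : ∃ λ g → Q g × (∀ ρ → dividesAll ρ g)
      common = gcd-mem-Fun ideal r dividesAll
        (λ {ρ} {ρ′} {g} ρ≗ div ρ′∈I κ → subst (g ∣_) (det-cong r (λ a b → cong (λ i → A i (κ b)) (ρ≗ a)))
          (div (λ t → subst I (sym (ρ≗ t)) (ρ′∈I t)) κ))
        (λ ρ g′∣g div ρ∈I κ → ∣ₚ.∣-trans g′∣g (div ρ∈I κ)) has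
      g = proj₁ common
      Qg = proj₁ (proj₂ common)
      g∣1 : g ∣ 1ℤ
      g∣1 = unit g (λ ρ κ ρ∈I → proj₂ (proj₂ common) ρ ρ∈I κ)

-- Saturated lattices and unimodular pairings

rationalSpan-linear : ∀ {k n} {V : Fin k → Fin n → ℤ} {u v} a b → RationalSpan V u → RationalSpan V v →
                      RationalSpan V (λ j → a * u j + b * v j)
rationalSpan-linear {V = V} {u} {v} a b (E , c , E≢0 , Eu≗) (F , d , F≢0 , Fv≗) =
  E * F , (λ t → a * F * c t + b * E * d t) , *-≢0 E≢0 F≢0 , λ j →
    trans (lemma E F a b (u j) (v j)) (trans (cong₂ (λ x y → a * F * x + b * E * y) (Eu≗ j) (Fv≗ j))
      (sym (dot-linearʳ (λ t → V t j) c d (a * F) (b * E))))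
  where
  lemma : ∀ E F a b u v → E * F * (a * u + b * v) ≡ a * F * (E * u) + b * E * (F * v)
  lemma = solve-∀

rationalSpan-divide : ∀ {k n} {V : Fin k → Fin n → ℤ} {u v : Fin n → ℤ} {g} → g ≢ 0ℤ → (∀ j → u j ≡ v j * g) →
                      RationalSpan V u → RationalSpan V v
rationalSpan-divide {u = u} {v} {g} g≢0 u≗ (E , c , E≢0 , Eu≗) =
  E * g , c , *-≢0 E≢0 g≢0 , λ j → trans (lemma E g (v j)) (trans (cong (E *_) (sym (u≗ j))) (Eu≗ j))
  where
  lemma : ∀ E g v → E * g * v ≡ E * (v * g)
  lemma = solve-∀

rationalSpan-gen : ∀ {k n} (V : Fin k → Fin n → ℤ) t → RationalSpan V (V t)
rationalSpan-gen V t = 1ℤ , δ t , (λ ()) , λ j →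
  trans (ℤₚ.*-identityˡ (V t j)) (sym (trans (dot-comm (λ s → V s j) (δ t)) (dot-δ t (λ s → V s j))))

rationalSpan-zero : ∀ {k n} {V : Fin k → Fin n → ℤ} → RationalSpan V (λ _ → 0ℤ)
rationalSpan-zero {V = V} = 1ℤ , (λ _ → 0ℤ) , (λ ()) , λ j → sym (dot-zeroʳ (λ t → V t j))

-- `φ` is a Bézout vector: the values of functionals at `u` form an ideal containing every entry of
-- `u`.
content : ∀ {n} (u : Fin n → ℤ) → ∃ λ φ → ∀ j → dot φ u ∣ u j
content {n} u with gcd-mem-Fin ideal n (λ j g → g ∣ u j) (λ j → ∣ₚ.∣-trans)
                     (λ j → u j , (δ j , dot-δ j u) , ∣ₚ.∣-refl)
  where
  ideal : IsIdeal (λ e → ∃ λ φ → dot φ u ≡ e)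
  ideal = record
    { zero-mem = (λ _ → 0ℤ) , trans (dot-comm (λ _ → 0ℤ) u) (dot-zeroʳ u)
    ; linear-mem = λ { a b (φ , φu≡) (ψ , ψu≡) → (λ j → a * φ j + b * ψ j) ,
        trans (dot-linearˡ φ ψ u a b) (cong₂ (λ x y → a * x + b * y) φu≡ ψu≡) } }
... | g , (φ , refl) , g∣u = φ , g∣u

-- reduce is the invariant that makes room for one more vector: a row of A outside the span of v
-- becomes, after subtracting u and dividing by its content, a primitive vector killed by all φ.
record UnimodularPairing {k n} (V : Fin k → Fin n → ℤ) : Set where
  field
    v φ      : Fin k → Fin n → ℤ
    v∈span   : ∀ a → RationalSpan V (v a)
    pairing  : det k (λ a b → dot (φ b) (v a)) ≡ 1ℤ
    reduce   : ∀ x → ∃ λ u → RationalSpan V u × (∀ b → dot (φ b) u ≡ dot (φ b) x)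

-- The old functionals kill `v₀`, so the pairing matrix is block triangular, and expansion along its
-- first row leaves `dot φ₀ v₀ ≡ 1ℤ` times the old determinant.
unimodularPairing : ∀ k {n} (V : Fin k → Fin n → ℤ) → LinIndep V → UnimodularPairing V
unimodularPairing zero    V indep = record
  { v = λ () ; φ = λ () ; v∈span = λ () ; pairing = refl ; reduce = λ x → (λ _ → 0ℤ) , rationalSpan-zero {V = V} , λ () }
unimodularPairing (suc k) {n} V indep = record
  { v = v₀ ∷ v ; φ = φ₀ ∷ φ
  ; v∈span = λ { zero → v₀∈span ; (suc a) → rationalSpan-tail {V = V} {v a} (v∈span a) }
  ; pairing = trans (Σℤ-single (λ j → sgn (toℕ j) * (dot ((φ₀ ∷ φ) j) v₀ * minor j)) zero off-diagonal)
      (trans (lemma₁ (dot φ₀ v₀) (minor zero)) (cong₂ _*_ φ₀v₀≡1 pairing))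
  ; reduce = reduce⁺ }
  where
  open ≡-Reasoning
  open UnimodularPairing (unimodularPairing k (V ∘ suc)
    (λ l Vl≡0 t → indep (0ℤ ∷ l) (λ j → trans (cong (_+ comb (V ∘ suc) l j) (ℤₚ.*-zeroʳ (V zero j)))
       (trans (ℤₚ.+-identityˡ _) (Vl≡0 j))) (suc t)))
  lemma₁ : ∀ p q → 1ℤ * (p * q) ≡ p * q
  lemma₁ = solve-∀
  u = proj₁ (reduce (V zero))
  u∈span : RationalSpan V u
  u∈span = rationalSpan-tail {V = V} {u} (proj₁ (proj₂ (reduce (V zero))))
  v′ : Fin n → ℤ
  v′ j = 1ℤ * V zero j + - 1ℤ * u j
  v′≢0 : ¬ (∀ j → v′ j ≡ 0ℤ)
  v′≢0 v′≡0 with proj₁ (proj₂ (reduce (V zero)))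
  ... | E , c , E≢0 , Eu≗ = E≢0 (indep (E ∷ (λ t → - 1ℤ * c t)) (λ j → begin
        V zero j * E + comb (V ∘ suc) (λ t → - 1ℤ * c t) j
      ≡⟨ cong (V zero j * E +_) (trans (dot-*ʳ (λ t → V (suc t) j) c (- 1ℤ)) (cong (- 1ℤ *_) (sym (Eu≗ j)))) ⟩
        V zero j * E + - 1ℤ * (E * u j)
      ≡⟨ lemma (V zero j) E (u j) ⟩
        E * v′ j
      ≡⟨ trans (cong (E *_) (v′≡0 j)) (ℤₚ.*-zeroʳ E) ⟩
        0ℤ ∎) zero)
    where
    lemma : ∀ a E u → a * E + - 1ℤ * (E * u) ≡ E * (1ℤ * a + - 1ℤ * u)
    lemma = solve-∀
  φ₀ = proj₁ (content v′)
  g = dot φ₀ v′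
  v₀ : Fin n → ℤ
  v₀ j = _∣_.quotient (proj₂ (content v′) j)
  v′≗ : ∀ j → v′ j ≡ v₀ j * g
  v′≗ j = _∣_.equality (proj₂ (content v′) j)
  g≢0 : g ≢ 0ℤ
  g≢0 g≡0 = v′≢0 (λ j → trans (v′≗ j) (trans (cong (v₀ j *_) g≡0) (ℤₚ.*-zeroʳ (v₀ j))))
  dot-v′ : ∀ ψ → dot ψ v′ ≡ g * dot ψ v₀
  dot-v′ ψ = trans (dot-congʳ ψ (λ j → trans (v′≗ j) (ℤₚ.*-comm (v₀ j) g))) (dot-*ʳ ψ v₀ g)
  φ₀v₀≡1 : dot φ₀ v₀ ≡ 1ℤ
  φ₀v₀≡1 = *-cancel g≢0 _ _ (trans (sym (dot-v′ φ₀)) (sym (ℤₚ.*-identityʳ g)))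
  φv₀≡0 : ∀ b → dot (φ b) v₀ ≡ 0ℤ
  φv₀≡0 b = *-zero-cancel g≢0 (begin
      g * dot (φ b) v₀
    ≡⟨ dot-v′ (φ b) ⟨
      dot (φ b) v′
    ≡⟨ dot-linearʳ (φ b) (V zero) u 1ℤ (- 1ℤ) ⟩
      1ℤ * dot (φ b) (V zero) + - 1ℤ * dot (φ b) u
    ≡⟨ cong (λ z → 1ℤ * dot (φ b) (V zero) + - 1ℤ * z) (proj₂ (proj₂ (reduce (V zero))) b) ⟩
      1ℤ * dot (φ b) (V zero) + - 1ℤ * dot (φ b) (V zero)
    ≡⟨ lemma (dot (φ b) (V zero)) ⟩
      0ℤ ∎)
    where
    lemma : ∀ a → 1ℤ * a + - 1ℤ * a ≡ 0ℤ
    lemma = solve-∀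
  v₀∈span : RationalSpan V v₀
  v₀∈span = rationalSpan-divide {V = V} {v′} {v₀} g≢0 v′≗
    (rationalSpan-linear {V = V} {V zero} {u} 1ℤ (- 1ℤ) (rationalSpan-gen V zero) u∈span)
  minor : Fin (suc k) → ℤ
  minor j = det k (λ a b → dot ((φ₀ ∷ φ) (punchIn j b)) (v a))
  off-diagonal : ∀ j → j ≢ zero → sgn (toℕ j) * (dot ((φ₀ ∷ φ) j) v₀ * minor j) ≡ 0ℤ
  off-diagonal zero    j≢0 = ⊥-elim (j≢0 refl)
  off-diagonal (suc j) _   = trans (cong (λ z → sgn (toℕ (Fin.suc j)) * (z * minor (suc j))) (φv₀≡0 j))
    (trans (cong (sgn (toℕ (Fin.suc j)) *_) (ℤₚ.*-zeroˡ (minor (suc j)))) (ℤₚ.*-zeroʳ (sgn (toℕ (Fin.suc j)))))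
  reduce⁺ : ∀ x → ∃ λ u → RationalSpan V u × (∀ b → dot ((φ₀ ∷ φ) b) u ≡ dot ((φ₀ ∷ φ) b) x)
  reduce⁺ x = u⁺ , rationalSpan-linear {V = V} {u′} {v₀} 1ℤ e (rationalSpan-tail {V = V} {u′} (proj₁ (proj₂ (reduce x)))) v₀∈span ,
      λ { zero → trans (dot-linearʳ φ₀ u′ v₀ 1ℤ e) (trans (cong (λ z → 1ℤ * dot φ₀ u′ + e * z) φ₀v₀≡1) (lemma (dot φ₀ x) (dot φ₀ u′)))
        ; (suc b) → trans (dot-linearʳ (φ b) u′ v₀ 1ℤ e) (trans (cong₂ (λ y z → 1ℤ * y + e * z) (proj₂ (proj₂ (reduce x)) b) (φv₀≡0 b))
                      (lemma′ (dot (φ b) x) e)) }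
    where
    u′ = proj₁ (reduce x)
    -- Adding `e` times `v₀` corrects the value of `φ₀` and leaves those of the old functionals
    -- alone.
    e = dot φ₀ x - dot φ₀ u′
    u⁺ : Fin n → ℤ
    u⁺ j = 1ℤ * u′ j + e * v₀ j
    lemma : ∀ p q → 1ℤ * q + (p - q) * 1ℤ ≡ p
    lemma = solve-∀
    lemma′ : ∀ p e → 1ℤ * p + e * 0ℤ ≡ p
    lemma′ = solve-∀

-- By multilinearity the unimodular pairing determinant is an integer combination of minors of A.
saturated⇒unit-gcd : ∀ {m n r} (A : Fin m → Fin n → ℤ) (I : Fin m → Set) (ρ : Fin r → Fin m) → LinIndep (A ∘ ρ) →
  (∀ w → RationalSpan (A ∘ ρ) w → RowLattice A I w) → UnitGCDOfMinors A I r
saturated⇒unit-gcd {m} {n} {r} A I ρ indep saturated d d∣minors = subst (d ∣_) pairing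
  (∣det-rowLattice (λ i b → dot (φ b) (A i)) I d∣row-minors (λ a b → dot (φ b) (v a)) rows)
  where
  open UnimodularPairing (unimodularPairing r (A ∘ ρ) indep)
  rows : ∀ a → RowLattice (λ i b → dot (φ b) (A i)) I (λ b → dot (φ b) (v a))
  rows a with saturated (v a) (v∈span a)
  ... | z , z∈I , v≗ = z , z∈I , λ b → trans (dot-congʳ (φ b) v≗)
    (trans (dot-comm (φ b) (comb A z)) (trans (dot-comb A z (φ b)) (dot-congˡ z (λ i → dot-comm (A i) (φ b)))))
  d∣row-minors : ∀ (σ : Fin r → Fin m) → (∀ t → I (σ t)) → d ∣ det r (λ a b → dot (φ b) (A (σ a)))
  d∣row-minors σ σ∈I = subst (d ∣_) (sym (det-transpose r (λ a b → dot (φ b) (A (σ a)))))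
    (∣det-rowLattice (λ j a → A (σ a) j) (λ _ → ⊤)
      (λ κ _ → subst (d ∣_) (det-transpose r (λ a b → A (σ a) (κ b))) (d∣minors σ κ σ∈I))
      (λ b a → dot (φ b) (A (σ a)))
      (λ b → φ b , (λ _ → inj₂ tt) , λ a → dot-comm (φ b) (A (σ a))))

-- Common denominators

toℚᵘ-ι : ∀ z → toℚᵘ (ι z) ℚᵘ.≃ mkℚᵘ z 0
toℚᵘ-ι z = ℚₚ.toℚᵘ-fromℚᵘ (mkℚᵘ z 0)

ι-+ : ∀ a b → ι (a + b) ≡ ι a ℚ.+ ι b
ι-+ a b = ℚₚ.toℚᵘ-injective (ℚᵘₚ.≃-trans (toℚᵘ-ι (a + b)) (ℚᵘₚ.≃-trans (*≡* (lemma a b))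
  (ℚᵘₚ.≃-sym (ℚᵘₚ.≃-trans (ℚₚ.toℚᵘ-homo-+ (ι a) (ι b)) (ℚᵘₚ.+-cong (toℚᵘ-ι a) (toℚᵘ-ι b))))))
  where
  lemma : ∀ a b → (a + b) * 1ℤ ≡ (a * 1ℤ + b * 1ℤ) * 1ℤ
  lemma = solve-∀

ι-* : ∀ a b → ι (a * b) ≡ ι a ℚ.* ι b
ι-* a b = ℚₚ.toℚᵘ-injective (ℚᵘₚ.≃-trans (toℚᵘ-ι (a * b)) (ℚᵘₚ.≃-trans (*≡* refl)
  (ℚᵘₚ.≃-sym (ℚᵘₚ.≃-trans (ℚₚ.toℚᵘ-homo-* (ι a) (ι b)) (ℚᵘₚ.*-cong (toℚᵘ-ι a) (toℚᵘ-ι b))))))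

ι-mono-≤ : ∀ {a b} → a ≤ b → ι a ℚ.≤ ι b
ι-mono-≤ {a} {b} a≤b = ℚₚ.toℚᵘ-cancel-≤ (ℚᵘₚ.≤-respˡ-≃ (ℚᵘₚ.≃-sym (toℚᵘ-ι a)) (ℚᵘₚ.≤-respʳ-≃ (ℚᵘₚ.≃-sym (toℚᵘ-ι b))
  (*≤* (ℤₚ.*-monoʳ-≤-nonNeg 1ℤ a≤b))))

ι-cancel-≤ : ∀ {a b} → ι a ℚ.≤ ι b → a ≤ b
ι-cancel-≤ {a} {b} ιa≤ιb = ℤₚ.*-cancelʳ-≤-pos a b 1ℤ
  (ℚᵘₚ.drop-*≤* (ℚᵘₚ.≤-respˡ-≃ (toℚᵘ-ι a) (ℚᵘₚ.≤-respʳ-≃ (toℚᵘ-ι b) (ℚₚ.toℚᵘ-mono-≤ ιa≤ιb))))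

ι-injective : ∀ {a b} → ι a ≡ ι b → a ≡ b
ι-injective eq = ℤₚ.≤-antisym (ι-cancel-≤ (ℚₚ.≤-reflexive eq)) (ι-cancel-≤ (ℚₚ.≤-reflexive (sym eq)))

-- Rational vectors are handled through a common denominator D, so that all of the linear
-- algebra takes place over ℤ.
infix 4 _≈_/_
record _≈_/_ (q : ℚ) (s D : ℤ) : Set where
  constructor fraction
  field cleared : ι D ℚ.* q ≡ ι s
open _≈_/_

toℚᵘ≃⇒≈ : ∀ {q s d} → toℚᵘ q ℚᵘ.≃ mkℚᵘ s d → q ≈ s / pos (suc d)
toℚᵘ≃⇒≈ {q} {s} {d} q≃ = fraction (ℚₚ.toℚᵘ-injective (ℚᵘₚ.≃-trans (ℚₚ.toℚᵘ-homo-* (ι (pos (suc d))) q)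
  (ℚᵘₚ.≃-trans (ℚᵘₚ.*-cong (toℚᵘ-ι (pos (suc d))) q≃) (ℚᵘₚ.≃-trans (*≡* eq) (ℚᵘₚ.≃-sym (toℚᵘ-ι s))))))
  where
  lemma : ∀ D s → D * s * 1ℤ ≡ s * D
  lemma = solve-∀
  eq : pos (suc d) * s * 1ℤ ≡ s * pos (suc (d ℕ.+ 0))
  eq = trans (lemma (pos (suc d)) s) (cong (λ e → s * pos (suc e)) (sym (ℕₚ.+-identityʳ d)))

≈-exists-fraction : ∀ q → ∃ λ D → ∃ λ s → 0ℤ < D × q ≈ s / D
≈-exists-fraction q@(mkℚ s d _) = pos (suc d) , s , +<+ (ℕ.s≤s ℕ.z≤n) , toℚᵘ≃⇒≈ ℚᵘₚ.≃-refl

≈-exists-rational : ∀ {D} → 0ℤ < D → ∀ s → ∃ λ q → q ≈ s / D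
≈-exists-rational {pos (suc d)} _ s = fromℚᵘ (mkℚᵘ s d) , toℚᵘ≃⇒≈ (ℚₚ.toℚᵘ-fromℚᵘ (mkℚᵘ s d))
≈-exists-rational {pos zero} (+<+ ())

≈-scale : ∀ {q s D} E → q ≈ s / D → q ≈ E * s / (E * D)
≈-scale {q} {s} {D} E (fraction q≈) = fraction (trans (cong (ℚ._* q) (ι-* E D)) (trans (ℚₚ.*-assoc (ι E) (ι D) q)
  (trans (cong (ι E ℚ.*_) q≈) (sym (ι-* E s)))))

≈-ι : ∀ D a → ι a ≈ D * a / D
≈-ι D a = fraction (sym (ι-* D a))

≈-zero : ∀ D → 0ℚ ≈ 0ℤ / D
≈-zero D = fraction (ℚₚ.*-zeroʳ (ι D))

≈-+ : ∀ {q q′ s s′ D} → q ≈ s / D → q′ ≈ s′ / D → q ℚ.+ q′ ≈ s + s′ / D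
≈-+ {q} {q′} {s} {s′} {D} (fraction q≈) (fraction q′≈) =
  fraction (trans (ℚₚ.*-distribˡ-+ (ι D) q q′) (trans (cong₂ ℚ._+_ q≈ q′≈) (sym (ι-+ s s′))))

≈-ι* : ∀ {q s D} a → q ≈ s / D → ι a ℚ.* q ≈ a * s / D
≈-ι* {q} {s} {D} a (fraction q≈) = fraction (trans (sym (ℚₚ.*-assoc (ι D) (ι a) q))
  (trans (cong (ℚ._* q) (ℚₚ.*-comm (ι D) (ι a)))
    (trans (ℚₚ.*-assoc (ι a) (ι D) q) (trans (cong (ι a ℚ.*_) q≈) (sym (ι-* a s))))))

≈-Σ : ∀ {k D} {q : Fin k → ℚ} {s} → (∀ i → q i ≈ s i / D) → Σℚ q ≈ Σℤ s / D
≈-Σ {zero}  {D} q≈ = ≈-zero D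
≈-Σ {suc k} {D} q≈ = ≈-+ (q≈ zero) (≈-Σ (q≈ ∘ suc))

≈-dot : ∀ {k D} {y : Fin k → ℚ} {Y} (u : Fin k → ℤ) → (∀ i → y i ≈ Y i / D) →
        Σℚ (λ i → ι (u i) ℚ.* y i) ≈ dot u Y / D
≈-dot u y≈ = ≈-Σ (λ i → ≈-ι* (u i) (y≈ i))

≈-unique : ∀ {q q′ s s′ D} → q ≈ s / D → q′ ≈ s′ / D → q ≡ q′ → s ≡ s′
≈-unique (fraction q≈) (fraction q′≈) refl = ι-injective (trans (sym q≈) q′≈)

≈-mono-≤ : ∀ {q q′ s s′ D} → 0ℤ < D → q ≈ s / D → q′ ≈ s′ / D → q ℚ.≤ q′ → s ≤ s′
≈-mono-≤ {D = D} 0<D (fraction q≈) (fraction q′≈) q≤q′ = ι-cancel-≤ (subst (ℚ._≤ _) q≈ (subst (_ ℚ.≤_) q′≈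
  (ℚₚ.*-monoˡ-≤-nonNeg (ι D) {{ℚ.nonNegative (ι-mono-≤ (ℤₚ.<⇒≤ 0<D))}} q≤q′)))

≈-cancel-≤ : ∀ {q q′ s s′ D} → 0ℤ < D → q ≈ s / D → q′ ≈ s′ / D → s ≤ s′ → q ℚ.≤ q′
≈-cancel-≤ {q} {q′} {D = D} 0<D (fraction q≈) (fraction q′≈) s≤s′ = ℚₚ.*-cancelˡ-≤-pos (ι D) {{ℚ.positive ι0<ιD}}
  (subst (ℚ._≤ ι D ℚ.* q′) (sym q≈) (subst (_ ℚ.≤_) (sym q′≈) (ι-mono-≤ s≤s′)))
  where
  ι0<ιD : 0ℚ ℚ.< ι D
  ι0<ιD = ℚₚ.≰⇒> (λ ιD≤0 → ℤₚ.<⇒≱ 0<D (ι-cancel-≤ ιD≤0))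

≈-cancel-≡ : ∀ {q q′ s s′ D} → 0ℤ < D → q ≈ s / D → q′ ≈ s′ / D → s ≡ s′ → q ≡ q′
≈-cancel-≡ 0<D q≈ q′≈ s≡s′ = ℚₚ.≤-antisym
  (≈-cancel-≤ 0<D q≈ q′≈ (ℤₚ.≤-reflexive s≡s′)) (≈-cancel-≤ 0<D q′≈ q≈ (ℤₚ.≤-reflexive (sym s≡s′)))

commonDenominator : ∀ {k} (y : Fin k → ℚ) → ∃ λ D → ∃ λ (Y : Fin k → ℤ) → 0ℤ < D × (∀ i → y i ≈ Y i / D)
commonDenominator {zero}  y = 1ℤ , (λ ()) , +<+ (ℕ.s≤s ℕ.z≤n) , λ ()
commonDenominator {suc k} y with ≈-exists-fraction (y zero) | commonDenominator (y ∘ suc)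
... | D₀ , s₀ , 0<D₀ , y₀≈ | D , Y , 0<D , y≈ =
  D * D₀ , (D * s₀) ∷ (λ i → D₀ * Y i) , 0<-* 0<D 0<D₀ ,
  λ { zero → ≈-scale D y₀≈
    ; (suc i) → subst (y (suc i) ≈ D₀ * Y i /_) (ℤₚ.*-comm D₀ D) (≈-scale D₀ (y≈ i)) }

≈-exists-vector : ∀ {k D} → 0ℤ < D → (Y : Fin k → ℤ) → ∃ λ y → ∀ i → y i ≈ Y i / D
≈-exists-vector 0<D Y = (λ i → proj₁ (≈-exists-rational 0<D (Y i))) , λ i → proj₂ (≈-exists-rational 0<D (Y i))

isPAdicVec⇒≈ : ∀ {k} p {y : Fin k → ℚ} → IsPAdicVec p y →
               ∃ λ K → ∃ λ (Y : Fin k → ℤ) → ∀ i → y i ≈ Y i / pos (p ℕ.^ K)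
isPAdicVec⇒≈ {zero}  p pAdic = 0 , (λ ()) , λ ()
isPAdicVec⇒≈ {suc k} p {y} pAdic with pAdic zero | isPAdicVec⇒≈ p (pAdic ∘ suc)
... | a , K₀ , y₀≈ | K , Y , y≈ = K ℕ.+ K₀ , (pos (p ℕ.^ K) * a) ∷ (λ i → pos (p ℕ.^ K₀) * Y i) ,
  λ { zero → subst (y zero ≈ pos (p ℕ.^ K) * a /_) p^K*p^K₀
               (≈-scale (pos (p ℕ.^ K)) (fraction (trans (ℚₚ.*-comm (ι (pos (p ℕ.^ K₀))) (y zero)) y₀≈)))
    ; (suc i) → subst (y (suc i) ≈ pos (p ℕ.^ K₀) * Y i /_) (trans (ℤₚ.*-comm (pos (p ℕ.^ K₀)) (pos (p ℕ.^ K))) p^K*p^K₀)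
               (≈-scale (pos (p ℕ.^ K₀)) (y≈ i)) }
  where
  p^K*p^K₀ : pos (p ℕ.^ K) * pos (p ℕ.^ K₀) ≡ pos (p ℕ.^ (K ℕ.+ K₀))
  p^K*p^K₀ = trans (sym (ℤₚ.pos-* (p ℕ.^ K) (p ℕ.^ K₀))) (cong pos (sym (ℕₚ.^-distribˡ-+-* p K K₀)))

Σℚ-cong : ∀ {k} {f g : Fin k → ℚ} → (∀ i → f i ≡ g i) → Σℚ f ≡ Σℚ g
Σℚ-cong {zero}  f≗g = refl
Σℚ-cong {suc k} f≗g = cong₂ ℚ._+_ (f≗g zero) (Σℚ-cong (f≗g ∘ suc))

linIndep⇒rowsIndependent : ∀ {m n k} (A : Matrix m n) (ρ : Fin k → Fin m) → LinIndep (A ∘ ρ) → RowsIndependent A ρ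
linIndep⇒rowsIndependent A ρ indep λs Σ≡0 t with commonDenominator λs
... | D , Y , 0<D , λs≈ = ≈-cancel-≡ 0<D (λs≈ t) (≈-zero D)
  (indep Y (λ j → ≈-unique (≈-dot (λ t → A (ρ t) j) λs≈) (≈-zero D)
    (trans (Σℚ-cong (λ t → ℚₚ.*-comm (ι (A (ρ t) j)) (λs t))) (Σ≡0 j))) t)

rowsIndependent⇒linIndep : ∀ {m n k} (A : Matrix m n) (ρ : Fin k → Fin m) → RowsIndependent A ρ → LinIndep (A ∘ ρ)
rowsIndependent⇒linIndep A ρ indep l Al≡0 t = ι-injective (indep (ι ∘ l) (λ j →
  trans (Σℚ-cong (λ t → ℚₚ.*-comm (ι (l t)) (ι (A (ρ t) j))))
    (≈-cancel-≡ (+<+ (ℕ.s≤s ℕ.z≤n)) (≈-dot (λ t → A (ρ t) j) (λ t → fraction {D = 1ℤ} (ℚₚ.*-identityˡ (ι (l t)))))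
       (≈-zero 1ℤ) (Al≡0 j))) t)

-- Linear programming duality

*-cancel-≤ : ∀ {σ x y} → 0ℤ < σ → σ * x ≤ σ * y → x ≤ y
*-cancel-≤ {σ} {x} {y} 0<σ = ℤₚ.*-cancelˡ-≤-pos x y σ {{ℤ.positive 0<σ}}

*-mono-≤ : ∀ {c x y} → 0ℤ ≤ c → x ≤ y → c * x ≤ c * y
*-mono-≤ {c} 0≤c = ℤₚ.*-monoˡ-≤-nonNeg c {{ℤ.nonNegative 0≤c}}

≤-from-0≤ : ∀ {x y} → 0ℤ ≤ y + - 1ℤ * x → x ≤ y
≤-from-0≤ {x} {y} 0≤ = ℤₚ.i-j≤0⇒i≤j (subst (_≤ 0ℤ) (lemma x y) (ℤₚ.neg-mono-≤ 0≤))
  where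
  lemma : ∀ x y → - (y + - 1ℤ * x) ≡ x - y
  lemma = solve-∀

0≤-from-≤ : ∀ {x y} → x ≤ y → 0ℤ ≤ y + - 1ℤ * x
0≤-from-≤ {x} {y} x≤y = subst (0ℤ ≤_) (lemma x y) (ℤₚ.i≤j⇒0≤j-i x≤y)
  where
  lemma : ∀ x y → y - x ≡ y + - 1ℤ * x
  lemma = solve-∀

commonDenominator₂ : ∀ {k} (y y′ : Fin k → ℚ) → ∃ λ D → ∃ λ (Y : Fin k → ℤ) → ∃ λ (Y′ : Fin k → ℤ) →
  0ℤ < D × (∀ i → y i ≈ Y i / D) × (∀ i → y′ i ≈ Y′ i / D)
commonDenominator₂ y y′ with commonDenominator y | commonDenominator y′
... | D , Y , 0<D , y≈ | D′ , Y′ , 0<D′ , y′≈ =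
  D′ * D , (λ i → D′ * Y i) , (λ i → D * Y′ i) , 0<-* 0<D′ 0<D , (λ i → ≈-scale D′ (y≈ i)) ,
  λ i → subst (y′ i ≈ D * Y′ i /_) (ℤₚ.*-comm D D′) (≈-scale D (y′≈ i))

module LP {m n} (A : Matrix m n) (b : IVec m) where

  -- `σ` times the slack of the point `X / σ`, in homogeneous form so that `σ` may also be zero or
  -- negative.
  slack : ℤ → (Fin n → ℤ) → Fin m → ℤ
  slack σ X i = σ * b i + - 1ℤ * dot (A i) X

  -- The duality gap as a sum of products of slacks and multipliers. Nonnegative terms give weak
  -- duality; if moreover the sum is at most 0, each term vanishes.
  gap : ∀ {D w Y} σ X → (∀ j → D * w j ≡ comb A Y j) → dot (slack σ X) Y ≡ σ * dot b Y + - 1ℤ * (D * dot w X)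
  gap {D} {w} {Y} σ X Dw≗ = trans (dot-linearˡ b (λ i → dot (A i) X) Y σ (- 1ℤ))
    (cong (λ z → σ * dot b Y + - 1ℤ * z) (trans (sym (dot-comb A Y X))
      (trans (dot-congˡ X (λ j → sym (Dw≗ j))) (dot-*ˡ w X D))))

  weak-duality : ∀ {D w Y σ X} → (∀ j → D * w j ≡ comb A Y j) → (∀ i → 0ℤ ≤ Y i) → (∀ i → 0ℤ ≤ slack σ X i) →
                 D * dot w X ≤ σ * dot b Y
  weak-duality {D} {w} {Y} {σ} {X} Dw≗ 0≤Y 0≤slack = ≤-from-0≤ (subst (0ℤ ≤_) (gap {D} {w} {Y} σ X Dw≗) (0≤-dot 0≤slack 0≤Y))

  complementary : ∀ {D w Y σ X} → (∀ j → D * w j ≡ comb A Y j) → (∀ i → 0ℤ ≤ Y i) → (∀ i → 0ℤ ≤ slack σ X i) →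
                  σ * dot b Y ≤ D * dot w X → ∀ i → Y i ≡ 0ℤ ⊎ slack σ X i ≡ 0ℤ
  complementary {D} {w} {Y} {σ} {X} Dw≗ 0≤Y 0≤slack σβ≤ i = Sum.swap (ℤₚ.i*j≡0⇒i≡0∨j≡0 (slack σ X i)
      (Σℤ≤0⇒≡0 {f = λ i → slack σ X i * Y i} (λ i → 0≤-* (0≤slack i) (0≤Y i)) (subst (_≤ 0ℤ) (sym (gap {D} {w} {Y} σ X Dw≗)) gap≤0) i))
    where
    lemma : ∀ x y → x - y ≡ x + - 1ℤ * y
    lemma = solve-∀
    gap≤0 : σ * dot b Y + - 1ℤ * (D * dot w X) ≤ 0ℤ
    gap≤0 = subst (_≤ 0ℤ) (lemma (σ * dot b Y) (D * dot w X)) (ℤₚ.i≤j⇒i-j≤0 σβ≤)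

  complementary⇒no-gap : ∀ {D w Y σ X} → (∀ j → D * w j ≡ comb A Y j) → (∀ i → Y i ≡ 0ℤ ⊎ slack σ X i ≡ 0ℤ) →
                         σ * dot b Y ≡ D * dot w X
  complementary⇒no-gap {D} {w} {Y} {σ} {X} Dw≗ cs = trans (lemma (σ * dot b Y) (D * dot w X))
      (trans (cong (_+ D * dot w X) (trans (sym (gap {D} {w} {Y} σ X Dw≗)) (Σℤ-zero vanish))) (ℤₚ.+-identityˡ _))
    where
    lemma : ∀ x y → x ≡ (x + - 1ℤ * y) + y
    lemma = solve-∀
    vanish : ∀ i → slack σ X i * Y i ≡ 0ℤ
    vanish i with cs i
    ... | inj₁ Y≡0 = trans (cong (slack σ X i *_) Y≡0) (ℤₚ.*-zeroʳ (slack σ X i))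
    ... | inj₂ s≡0 = trans (cong (_* Y i) s≡0) (ℤₚ.*-zeroˡ (Y i))

  module _ {x : QVec n} {σ : ℤ} {X : Fin n → ℤ} (0<σ : 0ℤ < σ) (x≈ : ∀ j → x j ≈ X j / σ) where

    inP⇒slack : InP A b x → ∀ i → 0ℤ ≤ slack σ X i
    inP⇒slack x∈P i = 0≤-from-≤ (≈-mono-≤ 0<σ (≈-dot (A i) x≈) (≈-ι σ (b i)) (x∈P i))

    slack⇒inP : (∀ i → 0ℤ ≤ slack σ X i) → InP A b x
    slack⇒inP 0≤slack i = ≈-cancel-≤ 0<σ (≈-dot (A i) x≈) (≈-ι σ (b i)) (≤-from-0≤ (0≤slack i))

    tight⇒slack≡0 : ∀ i → rowDot A i x ≡ ι (b i) → slack σ X i ≡ 0ℤ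
    tight⇒slack≡0 i tight = trans (cong (λ z → σ * b i + - 1ℤ * z) (≈-unique (≈-dot (A i) x≈) (≈-ι σ (b i)) tight))
        (lemma (σ * b i))
      where
      lemma : ∀ x → x + - 1ℤ * x ≡ 0ℤ
      lemma = solve-∀

    slack≡0⇒tight : ∀ i → slack σ X i ≡ 0ℤ → rowDot A i x ≡ ι (b i)
    slack≡0⇒tight i s≡0 = ≈-cancel-≡ 0<σ (≈-dot (A i) x≈) (≈-ι σ (b i))
        (trans (lemma (dot (A i) X) (σ * b i)) (trans (cong (σ * b i +_) (cong -_ s≡0)) (ℤₚ.+-identityʳ _)))
      where
      lemma : ∀ p q → p ≡ q + - (q + - 1ℤ * p)
      lemma = solve-∀

  module _ {y : QVec m} {D : ℤ} {Y : Fin m → ℤ} (0<D : 0ℤ < D) (y≈ : ∀ i → y i ≈ Y i / D) where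

    dualFeasible⇒comb : ∀ {w} → DualFeasible A w y → (∀ j → D * w j ≡ comb A Y j) × (∀ i → 0ℤ ≤ Y i)
    dualFeasible⇒comb {w} (Ay≡w , 0≤y) =
      (λ j → sym (≈-unique (≈-dot (λ i → A i j) y≈) (≈-ι D (w j)) (Ay≡w j))) ,
      λ i → ≈-mono-≤ 0<D (≈-zero D) (y≈ i) (0≤y i)

    comb⇒dualFeasible : ∀ {w} → (∀ j → D * w j ≡ comb A Y j) → (∀ i → 0ℤ ≤ Y i) → DualFeasible A w y
    comb⇒dualFeasible {w} Dw≗ 0≤Y =
      (λ j → ≈-cancel-≡ 0<D (≈-dot (λ i → A i j) y≈) (≈-ι D (w j)) (sym (Dw≗ j))) ,
      λ i → ≈-cancel-≤ 0<D (≈-zero D) (y≈ i) (0≤Y i)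

    zero⇒numerator≡0 : ∀ i → y i ≡ 0ℚ → Y i ≡ 0ℤ
    zero⇒numerator≡0 i = ≈-unique (y≈ i) (≈-zero D)

    numerator≡0⇒zero : ∀ i → Y i ≡ 0ℤ → y i ≡ 0ℚ
    numerator≡0⇒zero i = ≈-cancel-≡ 0<D (y≈ i) (≈-zero D)

  ComplementarySlackness : QVec m → QVec n → Set
  ComplementarySlackness y x = ∀ i → y i ≡ 0ℚ ⊎ rowDot A i x ≡ ι (b i)

  complementary⇒≡0 : ∀ {x σ} {X : Fin n → ℤ} {y D} {Y : Fin m → ℤ} → 0ℤ < σ → (∀ j → x j ≈ X j / σ) → 0ℤ < D → (∀ i → y i ≈ Y i / D) →
                     ComplementarySlackness y x → ∀ i → Y i ≡ 0ℤ ⊎ slack σ X i ≡ 0ℤ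
  complementary⇒≡0 {x} {σ} {X} {y} {D} {Y} 0<σ x≈ 0<D y≈ cs i = Sum.map (zero⇒numerator≡0 {y} {D} {Y} 0<D y≈ i) (tight⇒slack≡0 {x} {σ} {X} 0<σ x≈ i) (cs i)

  complementary⇒dualOptimal : ∀ {w x y} → InP A b x → DualFeasible A w y → ComplementarySlackness y x → DualOptimal A b w y
  complementary⇒dualOptimal {w} {x} {y} x∈P feas cs = feas , λ y′ feas′ →
    let σ , X , 0<σ , x≈ = commonDenominator x
        D , Y , Y′ , 0<D , y≈ , y′≈ = commonDenominator₂ y y′
        Dw≗ , _ = dualFeasible⇒comb 0<D y≈ {w} feas
        Dw≗′ , 0≤Y′ = dualFeasible⇒comb 0<D y′≈ {w} feas′
    in ≈-cancel-≤ 0<D (≈-dot b y≈) (≈-dot b y′≈) (*-cancel-≤ {σ} 0<σ (ℤₚ.≤-trans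
        (ℤₚ.≤-reflexive (complementary⇒no-gap {D} {w} {Y} {σ} {X} Dw≗ (complementary⇒≡0 {x} {σ} {X} {y} {D} {Y} 0<σ x≈ 0<D y≈ cs)))
        (weak-duality {D} {w} {Y′} {σ} {X} Dw≗′ 0≤Y′ (inP⇒slack {x} {σ} {X} 0<σ x≈ x∈P))))

  -- `y` has no gap at `x`, and `y′` costs no more than `y`, so its gap at `x` vanishes as well.
  dualOptimal⇒complementary : ∀ {w x y y′} → InP A b x → DualFeasible A w y → ComplementarySlackness y x →
                              DualOptimal A b w y′ → ComplementarySlackness y′ x
  dualOptimal⇒complementary {w} {x} {y} {y′} x∈P feas cs (feas′ , opt′) i =
    let σ , X , 0<σ , x≈ = commonDenominator x
        D , Y , Y′ , 0<D , y≈ , y′≈ = commonDenominator₂ y y′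
        Dw≗ , _ = dualFeasible⇒comb 0<D y≈ {w} feas
        Dw≗′ , 0≤Y′ = dualFeasible⇒comb 0<D y′≈ {w} feas′
        σβ′≤ = ℤₚ.≤-trans (*-mono-≤ (ℤₚ.<⇒≤ 0<σ) (≈-mono-≤ 0<D (≈-dot b y′≈) (≈-dot b y≈) (opt′ y feas)))
          (ℤₚ.≤-reflexive (complementary⇒no-gap {D} {w} {Y} {σ} {X} Dw≗ (complementary⇒≡0 {x} {σ} {X} {y} {D} {Y} 0<σ x≈ 0<D y≈ cs)))
    in Sum.map (numerator≡0⇒zero {y′} {D} {Y′} 0<D y′≈ i) (slack≡0⇒tight {x} {σ} {X} 0<σ x≈ i)
         (complementary {D} {w} {Y′} {σ} {X} Dw≗′ 0≤Y′ (inP⇒slack {x} {σ} {X} 0<σ x≈ x∈P) σβ′≤ i)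

-- Saturation from two primes: (2) ⇒ (3)

pos-^ : ∀ {p} → Prime p → ∀ k → 0ℤ < pos (p ℕ.^ k)
pos-^ {p} pp k = +<+ (ℕₚ.m^n>0 p {{prime⇒nonZero pp}} k)

zero-or : ∀ {P : Set} x → (x ≢ 0ℤ → P) → x ≡ 0ℤ ⊎ P
zero-or x nonzero with x ≟ 0ℤ
... | yes x≡0 = inj₁ x≡0
... | no  x≢0 = inj₂ (nonzero x≢0)

-- Adding enough copies of the rows ρ to w makes the coefficients nonnegative, hence an optimal
-- dual solution; a p-adic one is supported on the implicit equalities by complementary slackness.
pAdic-multiple : ∀ {m n} (A : Matrix m n) (b : IVec m) {p} → Prime p → TotallyDualPAdic p A b →
  ∀ c δ → NonemptyFace A b c δ → ∀ {r} (ρ : Fin r → Fin m) → (∀ t → ImplicitEq A b c δ (ρ t)) →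
  ∀ w → RationalSpan (A ∘ ρ) w → ∃ λ K → RowLattice A (ImplicitEq A b c δ) (λ j → pos (p ℕ.^ K) * w j)
pAdic-multiple {m} {n} A b {p} pp tdpa c δ′ (_ , x₀ , x₀∈F) {r} ρ ρ∈I w (E , cs , E≢0 , Ew≗) =
  conclude (tdpa w′ (y , optimal))
  where
  open LP A b
  I = ImplicitEq A b c δ′
  -- `E` is only known to be nonzero; its square is a positive denominator.
  D = E * E
  0<D : 0ℤ < D
  0<D = 0<-square E≢0
  C : Fin r → ℤ
  C t = E * cs t
  -- `N` bounds every `∣ C t ∣` and `D` is at least 1, so adding `D * N` makes all coefficients
  -- nonnegative.
  N = Σℤ (λ t → pos ∣ C t ∣)
  0≤∣C∣ : ∀ t → 0ℤ ≤ pos ∣ C t ∣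
  0≤∣C∣ t = +≤+ ℕ.z≤n
  C⁺ : Fin r → ℤ
  C⁺ t = 1ℤ * C t + D * N
  0≤C⁺ : ∀ t → 0ℤ ≤ C⁺ t
  0≤C⁺ t = subst (0ℤ ≤_) (lemma (C t) (pos ∣ C t ∣) D N)
      (0≤-+ (0≤∣x∣+x (C t)) (0≤-+ (0≤-from-≤ (≤-Σℤ 0≤∣C∣ t))
        (0≤-* (0≤-from-≤ (ℤₚ.i<j⇒suc[i]≤j 0<D)) (0≤-Σℤ 0≤∣C∣))))
    where
    lemma : ∀ c a D N → (a + c) + ((N + - 1ℤ * a) + (D + - 1ℤ * 1ℤ) * N) ≡ 1ℤ * c + D * N
    lemma = solve-∀
  Y : Fin m → ℤ
  Y = push ρ C⁺
  0≤Y : ∀ i → 0ℤ ≤ Y i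
  0≤Y i = 0≤-dot (λ t → 0≤-δ (ρ t) i) 0≤C⁺
  copies : Fin n → ℤ
  copies = comb (A ∘ ρ) (λ _ → N)
  w′ : Fin n → ℤ
  w′ j = w j + copies j
  Dw′≗ : ∀ j → D * w′ j ≡ comb A Y j
  Dw′≗ j = begin
      D * (w j + copies j)
    ≡⟨ lemma E (w j) (copies j) ⟩
      1ℤ * (E * (E * w j)) + D * copies j
    ≡⟨ cong (λ z → 1ℤ * z + D * copies j) (trans (cong (E *_) (Ew≗ j)) (sym (dot-*ʳ (λ t → A (ρ t) j) cs E))) ⟩
      1ℤ * comb (A ∘ ρ) C j + D * copies j
    ≡⟨ dot-linearʳ (λ t → A (ρ t) j) C (λ _ → N) 1ℤ D ⟨
      comb (A ∘ ρ) C⁺ j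
    ≡⟨ comb-push A ρ C⁺ j ⟨
      comb A Y j ∎
    where
    open ≡-Reasoning
    lemma : ∀ E w u → E * E * (w + u) ≡ 1ℤ * (E * (E * w)) + E * E * u
    lemma = solve-∀
  y = proj₁ (≈-exists-vector 0<D Y)
  y≈ = proj₂ (≈-exists-vector 0<D Y)
  feas : DualFeasible A w′ y
  feas = comb⇒dualFeasible 0<D y≈ Dw′≗ 0≤Y
  cs-face : ∀ x → InFace A b c δ′ x → ComplementarySlackness y x
  cs-face x x∈F i = Sum.map (numerator≡0⇒zero {y} {D} {Y} 0<D y≈ i) (λ i∈I → i∈I x x∈F)
    (push-supported {I = I} ρ C⁺ ρ∈I i)
  optimal : DualOptimal A b w′ y
  optimal = complementary⇒dualOptimal {w′} {x₀} {y} (proj₁ x₀∈F) feas (cs-face x₀ x₀∈F)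
  lemma₀ : ∀ w u P → 1ℤ * (P * (w + u)) + - P * u ≡ P * w
  lemma₀ = solve-∀
  conclude : (∃ λ y′ → DualOptimal A b w′ y′ × IsPAdicVec p y′) → ∃ λ K → RowLattice A I (λ j → pos (p ℕ.^ K) * w j)
  conclude (y′ , opt′ , pAdic) =
    let K , Z , y′≈ = isPAdicVec⇒≈ p {y′} pAdic
        P = pos (p ℕ.^ K)
        0<P = pos-^ pp K
        -- `y` is complementary to every point of the face, not just to `x₀`; a row with a nonzero
        -- entry of `y′` is therefore tight on the whole face.
        tight = λ i Z≢0 x x∈F → [ (λ y′≡0 → ⊥-elim (Z≢0 (zero⇒numerator≡0 {y′} {P} {Z} 0<P y′≈ i y′≡0))) , id ]′
          (dualOptimal⇒complementary {w′} {x} {y} {y′} (proj₁ x∈F) feas (cs-face x x∈F) opt′ i)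
        Pw′∈L : RowLattice A I (λ j → P * w′ j)
        Pw′∈L = Z , (λ i → zero-or (Z i) (tight i)) , proj₁ (dualFeasible⇒comb {y′} {P} {Z} 0<P y′≈ {w′} (proj₁ opt′))
    -- `copies` lies in the lattice itself, so the shift from `w` to `w′` can be undone.
    in K , rowLattice-cong {A = A} (λ j → lemma₀ (w j) (copies j) P)
         (rowLattice-linear {A = A} {I} {λ j → P * w′ j} {copies} 1ℤ (- P) Pw′∈L (rowLattice-comb {A = A} ρ (λ _ → N) ρ∈I))

primes-coprime : ∀ {p q} → Prime p → Prime q → p ≢ q → Coprime p q
primes-coprime {p} {q} pp pq p≢q (d∣p , d∣q) with prime⇒irreducible pp d∣p
... | inj₁ d≡1 = d≡1
... | inj₂ refl with prime⇒irreducible pq d∣q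
...   | inj₁ p≡1 = p≡1
...   | inj₂ p≡q = ⊥-elim (p≢q p≡q)

coprime-^ˡ : ∀ {a b} → Coprime a b → ∀ k → Coprime (a ℕ.^ k) b
coprime-^ˡ {a} {b} cop zero    (d∣1 , _) = ℕᵈ.∣1⇒≡1 d∣1
coprime-^ˡ {a} {b} cop (suc k) {d} (d∣ , d∣b) = coprime-^ˡ cop k (Coprime.coprime-divisor coprime-d-a d∣ , d∣b)
  where
  coprime-d-a : Coprime d a
  coprime-d-a (e∣d , e∣a) = cop (e∣a , ℕᵈ.∣-trans e∣d d∣b)

injective-or-repeats : ∀ {r k} (f : Fin r → Fin k) → Injective _≡_ _≡_ f ⊎ (∃ λ s → ∃ λ t → s ≢ t × f s ≡ f t)
injective-or-repeats f with any? (λ s → any? (λ t → ¬? (s ≟ᶠ t) ×-dec (f s ≟ᶠ f t)))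
... | yes (s , t , s≢t , fs≡ft) = inj₂ (s , t , s≢t , fs≡ft)
... | no  none = inj₁ (λ {s} {t} fs≡ft → decidable-stable (s ≟ᶠ t) (λ s≢t → none (s , t , s≢t , fs≡ft)))

cond2⇒cond3 : ∀ {m n} (A : Matrix m n) (b : IVec m) → Cond2 A b → Cond3 A b
cond2⇒cond3 {m} {n} A b (p , q , pp , pq , p≢q , tdp , tdq) c δ′ face r ((ρ , ρ∈I , indep) , _) d d∣subdets =
  ∣⇒∣ᵤ (saturated⇒unit-gcd A I ρ (rowsIndependent⇒linIndep A ρ indep) saturated d d∣minors)
  where
  I = ImplicitEq A b c δ′
  saturated : ∀ w → RationalSpan (A ∘ ρ) w → RowLattice A I w
  saturated w w∈span =
    let K , pw∈L = pAdic-multiple A b pp tdp c δ′ face ρ ρ∈I w w∈span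
        L , qw∈L = pAdic-multiple A b pq tdq c δ′ face ρ ρ∈I w w∈span
        g , gw∈L , g∣p^K , g∣q^L = gcd-mem {λ e → RowLattice A I (λ j → e * w j)} (multiplier-ideal A I w) {pos (p ℕ.^ K)} {pos (q ℕ.^ L)} pw∈L qw∈L
        ∣g∣≡1 = coprime-powers K L (∣⇒∣ᵤ g∣p^K , ∣⇒∣ᵤ g∣q^L)
    in unit-multiplier A I w {g} (∣ᵤ⇒∣ (ℕᵈ.∣-reflexive ∣g∣≡1)) gw∈L
    where
    coprime-powers : ∀ K L → Coprime (p ℕ.^ K) (q ℕ.^ L)
    coprime-powers K L = coprime-^ˡ (Coprime.sym (coprime-^ˡ (Coprime.sym (primes-coprime pp pq p≢q)) L)) K
  d∣0 : ∀ {x} → x ≡ 0ℤ → d ∣ x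
  d∣0 refl = ∣0
  d∣minors : ∀ (σ : Fin r → Fin m) (κ : Fin r → Fin n) → (∀ t → I (σ t)) → d ∣ det r (λ a b → A (σ a) (κ b))
  -- The hypothesis on `d` covers injective choices of rows and columns; a repetition makes the
  -- minor vanish.
  d∣minors σ κ σ∈I with injective-or-repeats σ | injective-or-repeats κ
  ... | inj₂ (s , t , s≢t , eq) | _ = d∣0 (det-alternating r s≢t (λ a b → A (σ a) (κ b)) (λ b → cong (λ i → A i (κ b)) eq))
  ... | inj₁ _ | inj₂ (s , t , s≢t , eq) = d∣0 (trans (det-transpose r (λ a b → A (σ a) (κ b)))
    (det-alternating r s≢t (λ b a → A (σ a) (κ b)) (λ a → cong (A (σ a)) eq)))
  ... | inj₁ σ-inj | inj₁ κ-inj = ∣ᵤ⇒∣ (d∣subdets (det r (λ a b → A (σ a) (κ b))) (σ , κ , σ-inj , κ-inj , σ∈I , refl))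

-- Strict complementarity

dot-Σʳ : ∀ {k m} (u : Fin m → ℤ) (Z : Fin k → Fin m → ℤ) →
         dot u (λ i → Σℤ (λ t → Z t i)) ≡ Σℤ (λ t → dot u (Z t))
dot-Σʳ u Z = trans (Σℤ-cong (λ i → sym (Σℤ-*ˡ (u i) (λ t → Z t i)))) (Σℤ-swap (λ i t → u i * Z t i))

module _ {m n} (A : Matrix m n) (b : IVec m) where
  open LP A b

  record IsScaledOptimal (w : Fin n → ℤ) (D : ℤ) (Y : Fin m → ℤ) : Set where
    field
      positive : 0ℤ < D
      nonneg   : ∀ i → 0ℤ ≤ Y i
      combines : ∀ j → D * w j ≡ comb A Y j
      optimal  : ∀ {D′ Y′} → 0ℤ < D′ → (∀ i → 0ℤ ≤ Y′ i) → (∀ j → D′ * w j ≡ comb A Y′ j) →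
                 D′ * dot b Y ≤ D * dot b Y′

  dualOptimal⇒scaled : ∀ {w y D Y} → DualOptimal A b w y → 0ℤ < D → (∀ i → y i ≈ Y i / D) → IsScaledOptimal w D Y
  dualOptimal⇒scaled {w} {y} {D} {Y} (feas , opt) 0<D y≈ = record
    { positive = 0<D
    ; nonneg   = proj₂ (dualFeasible⇒comb {y} {D} {Y} 0<D y≈ {w} feas)
    ; combines = proj₁ (dualFeasible⇒comb {y} {D} {Y} 0<D y≈ {w} feas)
    ; optimal  = λ {D′} {Y′} 0<D′ 0≤Y′ D′w≗ →
        let y′ , y′≈ = ≈-exists-vector 0<D′ Y′
            feas′ = comb⇒dualFeasible {y′} {D′} {Y′} 0<D′ y′≈ {w} D′w≗ 0≤Y′
        in ≈-mono-≤ (0<-* 0<D′ 0<D) (≈-scale D′ (≈-dot b y≈))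
             (subst (dotℤℚ b y′ ≈ D * dot b Y′ /_) (ℤₚ.*-comm D D′) (≈-scale D (≈-dot b y′≈))) (opt y′ feas′) }

  module Scaled {w D Y} (scaled : IsScaledOptimal w D Y) where
    open IsScaledOptimal scaled

    β : ℤ
    β = dot b Y

    -- Integer multiples (σ , X) of primal optimal points X / σ when σ > 0
    OptimalCone : ℤ → (Fin n → ℤ) → Set
    OptimalCone σ X = (∀ i → 0ℤ ≤ slack σ X i) × σ * β ≤ D * dot w X

    -- Coordinate `zero` stands for `σ`. Nonpositivity of the first functional bounds the gap by 0;
    -- that of the others says that the slacks are nonnegative.
    generators : Fin (suc m) → Fin (suc n) → ℤ
    generators zero    = β ∷ (λ j → - D * w j)
    generators (suc i) = (- 1ℤ * b i) ∷ A i

    generators≤0⇒optimalCone : ∀ X → (∀ i → dot (generators i) X ≤ 0ℤ) → OptimalCone (X zero) (X ∘ suc)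
    generators≤0⇒optimalCone X ≤0 =
        (λ i → subst (0ℤ ≤_) (lemma₁ (b i) (X zero) (dot (A i) (X ∘ suc))) (0≤-neg (≤0 (suc i)))) ,
        ≤-from-0≤ (subst (0ℤ ≤_) (trans (cong (λ z → - (β * X zero + z)) (dot-*ˡ w (X ∘ suc) (- D)))
          (lemma₂ β (X zero) D (dot w (X ∘ suc)))) (0≤-neg (≤0 zero)))
      where
      lemma₁ : ∀ b σ a → - (- 1ℤ * b * σ + a) ≡ σ * b + - 1ℤ * a
      lemma₁ = solve-∀
      lemma₂ : ∀ β σ D x → - (β * σ + - D * x) ≡ D * x + - 1ℤ * (σ * β)
      lemma₂ = solve-∀

    module _ {E : ℤ} {γ : Fin (suc n) → ℤ} {c : Fin (suc m) → ℤ} (Eγ≗ : ∀ j → E * γ j ≡ comb generators c j) where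

      certificate-value : E * γ zero ≡ β * c zero + - 1ℤ * dot b (c ∘ suc)
      certificate-value = trans (Eγ≗ zero) (cong (β * c zero +_) (dot-*ˡ b (c ∘ suc) (- 1ℤ)))

      certificate-comb : ∀ j → comb A (c ∘ suc) j ≡ E * γ (suc j) + c zero * (D * w j)
      certificate-comb j = trans (lemma (comb A (c ∘ suc) j) D (w j) (c zero)) (cong (_+ c zero * (D * w j)) (sym (Eγ≗ (suc j))))
        where
        lemma : ∀ a D w c → a ≡ (- D * w * c + a) + c * (D * w)
        lemma = solve-∀

    -- Farkas' lemma for the functional `σ`. A certificate would make `(Y + l) / (D * (1 + c₀))`
    -- dual feasible and cheaper than `Y / D` by `E / (D * (1 + c₀))`. Adding `Y` covers the case
    -- `c₀ = 0`.
    optimal-point : ∃ λ σ → ∃ λ X → 0ℤ < σ × OptimalCone σ X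
    optimal-point = conclude (farkas (suc m) generators γ)
      where
      γ : Fin (suc n) → ℤ
      γ = 1ℤ ∷ (λ _ → 0ℤ)
      conclude : (∃ λ X → (∀ i → dot (generators i) X ≤ 0ℤ) × 0ℤ < dot γ X) ⊎
                 (∃ λ E → ∃ λ c → 0ℤ < E × (∀ i → 0ℤ ≤ c i) × (∀ j → E * γ j ≡ comb generators c j)) →
                 ∃ λ σ → ∃ λ X → 0ℤ < σ × OptimalCone σ X
      conclude (inj₁ (X , ≤0 , 0<γX)) = X zero , X ∘ suc , subst (0ℤ <_) γX≡ 0<γX , generators≤0⇒optimalCone X ≤0
        where
        γX≡ : 1ℤ * X zero + dot (λ _ → 0ℤ) (X ∘ suc) ≡ X zero
        γX≡ = trans (cong₂ _+_ (ℤₚ.*-identityˡ (X zero)) (trans (dot-comm (λ _ → 0ℤ) (X ∘ suc)) (dot-zeroʳ (X ∘ suc))))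
                    (ℤₚ.+-identityʳ (X zero))
      conclude (inj₂ (E , c , 0<E , 0≤c , Eγ≗)) = ⊥-elim (ℤₚ.<⇒≱ 0<E E≤0)
        where
        c₀ = c zero
        l = c ∘ suc
        Y′ : Fin m → ℤ
        Y′ i = 1ℤ * Y i + 1ℤ * l i
        D′w≗ : ∀ j → D * (1ℤ + c₀) * w j ≡ comb A Y′ j
        D′w≗ j = trans (lemma E D c₀ (w j)) (trans (cong₂ (λ x y → 1ℤ * x + 1ℤ * y) (combines j)
            (sym (certificate-comb {E} {γ} {c} Eγ≗ j))) (sym (dot-linearʳ (λ i → A i j) Y l 1ℤ 1ℤ)))
          where
          lemma : ∀ E D c w → D * (1ℤ + c) * w ≡ 1ℤ * (D * w) + 1ℤ * (E * 0ℤ + c * (D * w))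
          lemma = solve-∀
        value : (1ℤ + c₀) * β ≤ 1ℤ * β + 1ℤ * dot b l
        value = *-cancel-≤ positive (subst (_≤ D * (1ℤ * β + 1ℤ * dot b l)) (ℤₚ.*-assoc D (1ℤ + c₀) β)
          (subst (λ z → D * (1ℤ + c₀) * β ≤ D * z) (dot-linearʳ b Y l 1ℤ 1ℤ)
            (optimal (0<-* positive (0<1+ (0≤c zero)))
              (λ i → 0≤-+ (0≤-* {1ℤ} (+≤+ ℕ.z≤n) (nonneg i)) (0≤-* {1ℤ} (+≤+ ℕ.z≤n) (0≤c (suc i)))) D′w≗)))
        E≤0 : E ≤ 0ℤ
        E≤0 = ≤-from-0≤ (subst (0ℤ ≤_) (trans (lemma β c₀ (dot b l))
            (cong (λ z → 0ℤ + - 1ℤ * z) (trans (sym (certificate-value {E} {γ} {c} Eγ≗)) (ℤₚ.*-identityʳ E)))) (0≤-from-≤ value))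
          where
          lemma : ∀ β c u → 1ℤ * β + 1ℤ * u + - 1ℤ * ((1ℤ + c) * β) ≡ 0ℤ + - 1ℤ * (β * c + - 1ℤ * u)
          lemma = solve-∀

    SlackPoint : Fin m → Set
    SlackPoint i = ∃ λ σ → ∃ λ X → 0ℤ < σ × OptimalCone σ X × 0ℤ < slack σ X i

    -- A vector that can be added to `Y` without losing optimality once the denominator is adjusted.
    -- It is not normalised to a dual solution because `multiple` may be 0.
    record OptimalDirection (i : Fin m) : Set where
      field
        multiple   : ℤ
        direction  : Fin m → ℤ
        multiple≥0 : 0ℤ ≤ multiple
        nonneg′    : ∀ k → 0ℤ ≤ direction k
        combines′  : ∀ j → comb A direction j ≡ multiple * (D * w j)
        value      : dot b direction ≡ multiple * β
        strict     : 0ℤ < direction i ⊎ SlackPoint i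

    module _ {σ₁ X₁} (0<σ₁ : 0ℤ < σ₁) (opt₁ : OptimalCone σ₁ X₁) {σ₂ X₂} (opt₂ : OptimalCone σ₂ X₂) where

      private
        K = 1ℤ + pos ∣ σ₂ ∣
        0≤K : 0ℤ ≤ K
        0≤K = +≤+ ℕ.z≤n

      -- A cone element with positive slack may have `σ₂ ≤ 0`. Adding `1 + ∣ σ₂ ∣` copies of a
      -- genuine optimal point makes `σ` positive and keeps the slack.
      slackPoint-shift : ∀ i → 0ℤ < slack σ₂ X₂ i → SlackPoint i
      slackPoint-shift i 0<s = K * σ₁ + σ₂ , X , 0<σ , (0≤slack , σβ≤) ,
          subst (0ℤ <_) (sym (slack≡ i)) (ℤₚ.+-mono-≤-< (0≤-* 0≤K (proj₁ opt₁ i)) 0<s)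
        where
        X : Fin n → ℤ
        X j = K * X₁ j + 1ℤ * X₂ j
        0<σ : 0ℤ < K * σ₁ + σ₂
        0<σ = subst (0ℤ <_) (lemma K σ₁ σ₂ (pos ∣ σ₂ ∣))
            (0<1+ (0≤-+ (0≤-* {pos ∣ σ₂ ∣} (+≤+ ℕ.z≤n) (0≤-from-≤ (ℤₚ.i<j⇒suc[i]≤j 0<σ₁)))
              (0≤-+ (0≤-from-≤ (ℤₚ.i<j⇒suc[i]≤j 0<σ₁)) (0≤∣x∣+x σ₂))))
          where
          lemma : ∀ K s t a → 1ℤ + (a * (s + - 1ℤ * 1ℤ) + ((s + - 1ℤ * 1ℤ) + (a + t))) ≡ (1ℤ + a) * s + t
          lemma = solve-∀
        slack≡ : ∀ i → slack (K * σ₁ + σ₂) X i ≡ K * slack σ₁ X₁ i + slack σ₂ X₂ i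
        slack≡ i = trans (cong (λ z → (K * σ₁ + σ₂) * b i + - 1ℤ * z) (dot-linearʳ (A i) X₁ X₂ K 1ℤ))
            (lemma K σ₁ σ₂ (b i) (dot (A i) X₁) (dot (A i) X₂))
          where
          lemma : ∀ K s t b x y → (K * s + t) * b + - 1ℤ * (K * x + 1ℤ * y) ≡ K * (s * b + - 1ℤ * x) + (t * b + - 1ℤ * y)
          lemma = solve-∀
        0≤slack : ∀ i → 0ℤ ≤ slack (K * σ₁ + σ₂) X i
        0≤slack i = subst (0ℤ ≤_) (sym (slack≡ i)) (0≤-+ (0≤-* 0≤K (proj₁ opt₁ i)) (proj₁ opt₂ i))
        σβ≤ : (K * σ₁ + σ₂) * β ≤ D * dot w X
        σβ≤ = subst (_≤ D * dot w X) (sym (lemma₁ K σ₁ σ₂ β)) (subst (K * (σ₁ * β) + σ₂ * β ≤_)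
            (trans (lemma₂ K D (dot w X₁) (dot w X₂)) (cong (D *_) (sym (dot-linearʳ w X₁ X₂ K 1ℤ))))
            (ℤₚ.+-mono-≤ (*-mono-≤ 0≤K (proj₂ opt₁)) (proj₂ opt₂)))
          where
          lemma₁ : ∀ K s t β → (K * s + t) * β ≡ K * (s * β) + t * β
          lemma₁ = solve-∀
          lemma₂ : ∀ K D x y → K * (D * x) + D * y ≡ D * (K * x + 1ℤ * y)
          lemma₂ = solve-∀

    -- Farkas' lemma for the slack of row `i` as a functional: a solution is an element of the cone
    -- with positive slack, and a certificate `l` becomes, with `E` added at `i`, a direction
    -- positive at `i`.
    optimal-direction : ∀ i → OptimalDirection i
    optimal-direction i = conclude (farkas (suc m) generators γ)
      where
      γ : Fin (suc n) → ℤ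
      γ = b i ∷ (λ j → - 1ℤ * A i j)
      conclude : (∃ λ X → (∀ i → dot (generators i) X ≤ 0ℤ) × 0ℤ < dot γ X) ⊎
                 (∃ λ E → ∃ λ c → 0ℤ < E × (∀ i → 0ℤ ≤ c i) × (∀ j → E * γ j ≡ comb generators c j)) →
                 OptimalDirection i
      conclude (inj₁ (X , ≤0 , 0<γX)) = record
        { multiple = 0ℤ ; direction = λ _ → 0ℤ ; multiple≥0 = ℤₚ.≤-refl ; nonneg′ = λ _ → ℤₚ.≤-refl
        ; combines′ = λ j → trans (dot-zeroʳ (λ i → A i j)) (sym (ℤₚ.*-zeroˡ (D * w j)))
        ; value = trans (dot-zeroʳ b) (sym (ℤₚ.*-zeroˡ β))
        ; strict = inj₂ (shift optimal-point) }
        where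
        0<slack : 0ℤ < slack (X zero) (X ∘ suc) i
        0<slack = subst (0ℤ <_) (cong₂ _+_ (ℤₚ.*-comm (b i) (X zero)) (dot-*ˡ (A i) (X ∘ suc) (- 1ℤ))) 0<γX
        shift : (∃ λ σ → ∃ λ X → 0ℤ < σ × OptimalCone σ X) → SlackPoint i
        shift (σ₁ , X₁ , 0<σ₁ , opt₁) = slackPoint-shift {σ₁} {X₁} 0<σ₁ opt₁ {X zero} {X ∘ suc} (generators≤0⇒optimalCone X ≤0) i 0<slack
      conclude (inj₂ (E , c , 0<E , 0≤c , Eγ≗)) = record
        { multiple = c zero ; direction = Z ; multiple≥0 = 0≤c zero
        ; nonneg′ = λ k → 0≤-+ (0≤-* {1ℤ} (+≤+ ℕ.z≤n) (0≤c (suc k))) (0≤-* (ℤₚ.<⇒≤ 0<E) (0≤-δ i k))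
        ; combines′ = λ j → trans (dot-linearʳ (λ k → A k j) l (δ i) 1ℤ E)
            (trans (cong₂ (λ x y → 1ℤ * x + E * y) (certificate-comb {E} {γ} {c} Eγ≗ j) (dot-δʳ (λ k → A k j)))
              (lemma₁ E (A i j) (c zero * (D * w j))))
        ; value = trans (dot-linearʳ b l (δ i) 1ℤ E) (trans (cong (λ y → 1ℤ * dot b l + E * y) (dot-δʳ b))
            (trans (cong (1ℤ * dot b l +_) (certificate-value {E} {γ} {c} Eγ≗)) (lemma₂ (dot b l) β (c zero))))
        ; strict = inj₁ (ℤₚ.+-mono-≤-< (0≤-* {1ℤ} (+≤+ ℕ.z≤n) (0≤c (suc i)))
            (subst (0ℤ <_) (sym (trans (cong (E *_) (δ-diag i)) (ℤₚ.*-identityʳ E))) 0<E)) }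
        where
        l = c ∘ suc
        Z : Fin m → ℤ
        Z k = 1ℤ * l k + E * δ i k
        dot-δʳ : ∀ (u : Fin m → ℤ) → dot u (δ i) ≡ u i
        dot-δʳ u = trans (dot-comm u (δ i)) (dot-δ i u)
        lemma₁ : ∀ E a x → 1ℤ * (E * (- 1ℤ * a) + x) + E * a ≡ x
        lemma₁ = solve-∀
        lemma₂ : ∀ u β c → 1ℤ * u + (β * c + - 1ℤ * u) ≡ c * β
        lemma₂ = solve-∀

    record StrictlyComplementary : Set where
      field
        {D°}     : ℤ
        {N}      : Fin m → ℤ
        0<D°     : 0ℤ < D°
        0≤N      : ∀ k → 0ℤ ≤ N k
        D°w≗     : ∀ j → D° * w j ≡ comb A N j
        tight    : ∀ {σ X} → OptimalCone σ X → ∀ i → N i ≡ 0ℤ ⊎ slack σ X i ≡ 0ℤ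
        strict   : ∀ i → 0ℤ < N i ⊎ SlackPoint i

    -- Add all directions to `Y`: their entries are nonnegative, so none destroys the positivity
    -- that another provides.
    strictlyComplementary : (∀ i → OptimalDirection i) → StrictlyComplementary
    strictlyComplementary dirs = record
      { 0<D° = 0<-* positive (0<1+ 0≤C)
      ; 0≤N = 0≤N
      ; D°w≗ = D°w≗
      ; tight = λ {σ} {X} opt → complementary {D * (1ℤ + C)} {w} {N} {σ} {X} D°w≗ 0≤N (proj₁ opt)
          (subst (_≤ D * (1ℤ + C) * dot w X) (sym (trans (cong (σ *_) value-N) (lemma₃ σ C β)))
            (subst ((1ℤ + C) * (σ * β) ≤_) (lemma₄ D C (dot w X)) (*-mono-≤ (ℤₚ.<⇒≤ (0<1+ 0≤C)) (proj₂ opt))))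
      ; strict = λ i → Sum.map₁ (λ 0<Zi → ℤₚ.<-≤-trans 0<Zi (Z≤N i)) (strict (dirs i)) }
      where
      open OptimalDirection
      Z : Fin m → Fin m → ℤ
      Z i = direction (dirs i)
      C = Σℤ (λ i → multiple (dirs i))
      0≤C : 0ℤ ≤ C
      0≤C = 0≤-Σℤ (λ i → multiple≥0 (dirs i))
      ΣZ : Fin m → ℤ
      ΣZ k = Σℤ (λ i → Z i k)
      N : Fin m → ℤ
      N k = 1ℤ * Y k + 1ℤ * ΣZ k
      0≤ΣZ : ∀ k → 0ℤ ≤ ΣZ k
      0≤ΣZ k = 0≤-Σℤ (λ i → nonneg′ (dirs i) k)
      0≤N : ∀ k → 0ℤ ≤ N k
      0≤N k = 0≤-+ (0≤-* {1ℤ} (+≤+ ℕ.z≤n) (nonneg k)) (0≤-* {1ℤ} (+≤+ ℕ.z≤n) (0≤ΣZ k))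
      Z≤N : ∀ i → Z i i ≤ N i
      Z≤N i = ℤₚ.≤-trans (≤-Σℤ (λ t → nonneg′ (dirs t) i) i)
          (≤-from-0≤ (subst (0ℤ ≤_) (lemma (Y i) (ΣZ i)) (nonneg i)))
        where
        lemma : ∀ y s → y ≡ (1ℤ * y + 1ℤ * s) + - 1ℤ * s
        lemma = solve-∀
      lemma₁ : ∀ D w C → D * (1ℤ + C) * w ≡ 1ℤ * (D * w) + 1ℤ * (C * (D * w))
      lemma₁ = solve-∀
      lemma₂ : ∀ β C → 1ℤ * β + 1ℤ * (C * β) ≡ (1ℤ + C) * β
      lemma₂ = solve-∀
      lemma₃ : ∀ σ C β → σ * ((1ℤ + C) * β) ≡ (1ℤ + C) * (σ * β)
      lemma₃ = solve-∀
      lemma₄ : ∀ D C x → (1ℤ + C) * (D * x) ≡ D * (1ℤ + C) * x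
      lemma₄ = solve-∀
      D°w≗ : ∀ j → D * (1ℤ + C) * w j ≡ comb A N j
      D°w≗ j = trans (lemma₁ D (w j) C) (trans (cong₂ (λ x y → 1ℤ * x + 1ℤ * y) (combines j)
        (sym (trans (dot-Σʳ (λ k → A k j) Z) (trans (Σℤ-cong (λ i → combines′ (dirs i) j)) (Σℤ-*ʳ (D * w j) (λ i → multiple (dirs i)))))))
        (sym (dot-linearʳ (λ k → A k j) Y ΣZ 1ℤ 1ℤ)))
      value-N : dot b N ≡ (1ℤ + C) * β
      value-N = trans (dot-linearʳ b Y ΣZ 1ℤ 1ℤ) (trans (cong (λ x → 1ℤ * β + 1ℤ * x)
        (trans (dot-Σʳ b Z) (trans (Σℤ-cong (λ i → value (dirs i))) (Σℤ-*ʳ β (λ i → multiple (dirs i)))))) (lemma₂ β C))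

-- Rounding to p-adic solutions: (3) ⇒ (1)

n<p^n : ∀ {p} → Prime p → ∀ n → n ℕ.< p ℕ.^ n
n<p^n pp zero    = ℕ.s≤s ℕ.z≤n
n<p^n {p} pp (suc n) = ℕₚ.≤-<-trans (n<p^n pp n)
  (ℕₚ.^-monoʳ-< p (ℕ.nonTrivial⇒n>1 p {{prime⇒nonTrivial pp}}) (ℕₚ.n<1+n n))

-- a / p^K approximates 1 / D from below
pAdic-approximation : ∀ {p} → Prime p → ∀ {D B} → 0ℤ < D → 0ℤ ≤ B → ∃ λ K → ∃ λ a → ∃ λ e →
  pos (p ℕ.^ K) ≡ a * D + e × 0ℤ ≤ e × e ≤ D × D * B ≤ a
pAdic-approximation {p} pp {pos (suc d)} {pos B} 0<D 0≤B =
  K , pos a , pos e , P≡ , +≤+ ℕ.z≤n , +≤+ (ℕₚ.<⇒≤ (m%n<n P (suc d))) , subst (_≤ pos a) (ℤₚ.pos-* (suc d) B) (+≤+ DB≤a)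
  where
  -- Since `K < p ^ K`, the quotient of `p ^ K` by the denominator reaches `D * B`, a bound for
  -- `e ∣ z i ∣` when `e ≤ D` and `∣ z i ∣ ≤ B`.
  K = (suc d ℕ.* B) ℕ.* suc d
  P = p ℕ.^ K
  a = P ℕ./ suc d
  e = P ℕ.% suc d
  P≡ : pos P ≡ pos a * pos (suc d) + pos e
  P≡ = trans (cong pos (m≡m%n+[m/n]*n P (suc d))) (trans (ℤₚ.pos-+ e (a ℕ.* suc d))
    (trans (ℤₚ.+-comm (pos e) (pos (a ℕ.* suc d))) (cong (_+ pos e) (ℤₚ.pos-* a (suc d)))))
  DB≤a : suc d ℕ.* B ℕ.≤ a
  DB≤a = subst (ℕ._≤ a) (m*n/n≡m (suc d ℕ.* B) (suc d)) (/-monoˡ-≤ (suc d) (ℕₚ.<⇒≤ (n<p^n pp K)))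
pAdic-approximation pp {pos zero} (+<+ ()) 0≤B

module _ {m n} (A : Matrix m n) (b : IVec m) where
  open LP A b

  module Face {w : IVec n} {y : QVec m} {D : ℤ} {Y : Fin m → ℤ} (y≈ : ∀ i → y i ≈ Y i / D)
              (scaled : IsScaledOptimal A b w D Y) where
    open IsScaledOptimal scaled
    open Scaled A b scaled
    open StrictlyComplementary (strictlyComplementary optimal-direction)

    c : QVec n
    c j = ι (w j)

    value : ℚ
    value = dotℤℚ b y

    I : Fin m → Set
    I = ImplicitEq A b c value

    module _ {x : QVec n} {σ : ℤ} {X : Fin n → ℤ} (0<σ : 0ℤ < σ) (x≈ : ∀ j → x j ≈ X j / σ) where

      primal≈ : Σℚ (λ j → c j ℚ.* x j) ≈ D * dot w X / (D * σ)
      primal≈ = ≈-scale D (≈-dot w x≈)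

      dual≈ : value ≈ σ * β / (D * σ)
      dual≈ = subst (value ≈ σ * β /_) (ℤₚ.*-comm σ D) (≈-scale σ (≈-dot b y≈))

      face⇒cone : InFace A b c value x → OptimalCone σ X
      face⇒cone (x∈P , cx≡) = inP⇒slack {x} {σ} {X} 0<σ x≈ x∈P , ℤₚ.≤-reflexive (≈-unique dual≈ primal≈ (sym cx≡))

      weak : InP A b x → D * dot w X ≤ σ * β
      weak x∈P = weak-duality {D} {w} {Y} {σ} {X} combines nonneg (inP⇒slack {x} {σ} {X} 0<σ x≈ x∈P)

      cone⇒face : OptimalCone σ X → InFace A b c value x
      cone⇒face (0≤slack , σβ≤) = x∈P , ≈-cancel-≡ (0<-* positive 0<σ) primal≈ dual≈ (ℤₚ.≤-antisym (weak x∈P) σβ≤)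
        where
        x∈P : InP A b x
        x∈P = slack⇒inP {x} {σ} {X} 0<σ x≈ 0≤slack

      valid-at : InP A b x → Σℚ (λ j → c j ℚ.* x j) ℚ.≤ value
      valid-at x∈P = ≈-cancel-≤ (0<-* positive 0<σ) primal≈ dual≈ (weak x∈P)

    face-point : ∃ λ x → InFace A b c value x
    face-point = let σ , X , 0<σ , opt = optimal-point
                     x , x≈ = ≈-exists-vector 0<σ X
                 in x , cone⇒face {x} {σ} {X} 0<σ x≈ opt

    nonemptyFace : NonemptyFace A b c value
    nonemptyFace = (λ x x∈P → let σ , X , 0<σ , x≈ = commonDenominator x in valid-at {x} {σ} {X} 0<σ x≈ x∈P) , face-point

    support⇒implicit : ∀ i → N i ≢ 0ℤ → I i
    support⇒implicit i N≢0 x x∈F =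
      let σ , X , 0<σ , x≈ = commonDenominator x
      in [ (λ N≡0 → ⊥-elim (N≢0 N≡0)) , slack≡0⇒tight {x} {σ} {X} 0<σ x≈ i ]′ (tight {σ} {X} (face⇒cone {x} {σ} {X} 0<σ x≈ x∈F) i)

    slackPoint⇒¬implicit : ∀ i → SlackPoint i → ¬ I i
    slackPoint⇒¬implicit i (σ , X , 0<σ , opt , 0<slack) i∈I =
      let x , x≈ = ≈-exists-vector 0<σ X
      in 0<⇒≢0 0<slack (tight⇒slack≡0 {x} {σ} {X} 0<σ x≈ i (i∈I x (cone⇒face {x} {σ} {X} 0<σ x≈ opt)))

    -- The two alternatives of strict complementarity are witnesses for and against: a positive
    -- entry of `N` forces tightness on the whole face, a slack point refutes it.
    implicit? : ∀ i → Dec (I i)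
    implicit? i = [ (λ 0<N → yes (support⇒implicit i (0<⇒≢0 0<N))) , (λ s → no (slackPoint⇒¬implicit i s)) ]′ (strict i)

    implicit⇒0<N : ∀ i → I i → 0ℤ < N i
    implicit⇒0<N i i∈I = [ id , (λ s → ⊥-elim (slackPoint⇒¬implicit i s i∈I)) ]′ (strict i)

    N-supported : SupportedOn I N
    N-supported i = zero-or (N i) (support⇒implicit i)

    integral-combination : Cond3 A b → RowLattice A I w
    integral-combination cond3 =
      -- Condition (3) takes the rank as an input; a basis of the implicit rows supplies it.
      let r , ρ , ρ∈I , indep , spans = exists-basis m A I implicit?
          maximal : ∀ (τ : Fin (suc r) → Fin m) → (∀ t → I (τ t)) → ¬ LinIndep (A ∘ τ)
          maximal = λ τ τ∈I → span⇒dependent (A ∘ ρ) (A ∘ τ) (λ t → spans (τ t) (τ∈I t))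
          rank : IsRankOf A I r
          rank = (ρ , ρ∈I , linIndep⇒rowsIndependent A ρ indep) ,
                 λ τ τ∈I independent → maximal τ τ∈I (rowsIndependent⇒linIndep A τ independent)
          unit : UnitGCDOfMinors A I r
          unit = λ d d∣minors → ∣ᵤ⇒∣ (cond3 c value nonemptyFace r rank d
            (λ { s (σ , κ , _ , _ , σ∈I , s≡) → subst (d ∣ᵤ_) (sym s≡) (∣⇒∣ᵤ (d∣minors σ κ σ∈I)) }))
      in unit-gcd⇒rowLattice A I implicit? {r} maximal {D°} (0<⇒≢0 0<D°) w N N-supported D°w≗ unit

    -- (a N + e z) / p^K is a combination of the relative interior point N / D° and the integral
    -- point z close enough to N / D° to be nonnegative.
    pAdic-optimal : ∀ {p} → Prime p → RowLattice A I w → ∃ λ y′ → DualOptimal A b w y′ × IsPAdicVec p y′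
    pAdic-optimal {p} pp (z , z∈I , w≗) = conclude (pAdic-approximation pp {D°} {B} 0<D° 0≤B)
      where
      B = Σℤ (λ i → pos ∣ z i ∣)
      0≤B : 0ℤ ≤ B
      0≤B = 0≤-Σℤ {f = λ i → pos ∣ z i ∣} (λ i → +≤+ ℕ.z≤n)
      conclude : (∃ λ K → ∃ λ a → ∃ λ e → pos (p ℕ.^ K) ≡ a * D° + e × 0ℤ ≤ e × e ≤ D° × D° * B ≤ a) →
                 ∃ λ y′ → DualOptimal A b w y′ × IsPAdicVec p y′
      conclude (K , a , e , P≡ , 0≤e , e≤D° , DB≤a) = y′ , optimal′ , pAdic
        where
        P = pos (p ℕ.^ K)
        0<P = pos-^ pp K
        0≤a : 0ℤ ≤ a
        0≤a = ℤₚ.≤-trans (0≤-* (ℤₚ.<⇒≤ 0<D°) 0≤B) DB≤a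
        Y′ : Fin m → ℤ
        Y′ i = a * N i + e * z i
        0≤Y′ : ∀ i → 0ℤ ≤ Y′ i
        0≤Y′ i = [ off , on ]′ (z∈I i)
          where
          off : z i ≡ 0ℤ → 0ℤ ≤ Y′ i
          off z≡0 = subst (λ z → 0ℤ ≤ a * N i + e * z) (sym z≡0) (0≤-+ (0≤-* 0≤a (0≤N i)) (0≤-* 0≤e ℤₚ.≤-refl))
          on : I i → 0ℤ ≤ Y′ i
          -- The chain a N ≥ a ≥ D° B ≥ e B ≥ e |z| ≥ - e z at `i`, with one summand for each
          -- inequality; the first uses that the integer `N i` is at least 1.
          on i∈I = subst (0ℤ ≤_) (lemma a (N i) D° B e (pos ∣ z i ∣) (z i))
              (0≤-+ (0≤-* 0≤a (0≤-from-≤ (ℤₚ.i<j⇒suc[i]≤j (implicit⇒0<N i i∈I))))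
                (0≤-+ (0≤-from-≤ DB≤a) (0≤-+ (0≤-* (0≤-from-≤ e≤D°) 0≤B)
                  (0≤-+ (0≤-* 0≤e (0≤-from-≤ (≤-Σℤ {f = λ i → pos ∣ z i ∣} (λ i → +≤+ ℕ.z≤n) i))) (0≤-* 0≤e (0≤∣x∣+x (z i)))))))
            where
            lemma : ∀ a N D B e v z → a * (N + - 1ℤ * 1ℤ) + ((a + - 1ℤ * (D * B)) +
              ((D + - 1ℤ * e) * B + (e * (B + - 1ℤ * v) + e * (v + z)))) ≡ a * N + e * z
            lemma = solve-∀
        Pw≗ : ∀ j → P * w j ≡ comb A Y′ j
        Pw≗ j = trans (cong (_* w j) P≡) (trans (lemma a D° e (w j))
            (trans (cong₂ (λ u v → a * u + e * v) (D°w≗ j) (w≗ j)) (sym (dot-linearʳ (λ i → A i j) N z a e))))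
          where
          lemma : ∀ a D e w → (a * D + e) * w ≡ a * (D * w) + e * w
          lemma = solve-∀
        y′ : QVec m
        y′ = proj₁ (≈-exists-vector 0<P Y′)
        y′≈ : ∀ i → y′ i ≈ Y′ i / P
        y′≈ = proj₂ (≈-exists-vector 0<P Y′)
        pAdic : IsPAdicVec p y′
        pAdic i = Y′ i , K , trans (ℚₚ.*-comm (y′ i) (ι P)) (_≈_/_.cleared (y′≈ i))
        off-support : ∀ i → ¬ I i → Y′ i ≡ 0ℤ
        off-support i i∉I = trans (cong₂ (λ u v → a * u + e * v)
            ([ id , (λ i∈I → ⊥-elim (i∉I i∈I)) ]′ (N-supported i)) ([ id , (λ i∈I → ⊥-elim (i∉I i∈I)) ]′ (z∈I i)))
          (cong₂ _+_ (ℤₚ.*-zeroʳ a) (ℤₚ.*-zeroʳ e))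
        cs : ComplementarySlackness y′ (proj₁ face-point)
        cs i = decide (implicit? i)
          where
          decide : Dec (I i) → y′ i ≡ 0ℚ ⊎ rowDot A i (proj₁ face-point) ≡ ι (b i)
          decide (yes i∈I) = inj₂ (i∈I (proj₁ face-point) (proj₂ face-point))
          decide (no  i∉I) = inj₁ (numerator≡0⇒zero {y′} {P} {Y′} 0<P y′≈ i (off-support i i∉I))
        optimal′ : DualOptimal A b w y′
        optimal′ = complementary⇒dualOptimal {w} {proj₁ face-point} {y′} (proj₁ (proj₂ face-point))
          (comb⇒dualFeasible {y′} {P} {Y′} 0<P y′≈ {w} Pw≗ 0≤Y′) cs

  cond3⇒cond1 : Cond3 A b → Cond1 A b
  cond3⇒cond1 cond3 p pp w (y , opt) =
    let D , Y , 0<D , y≈ = commonDenominator y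
        scaled = dualOptimal⇒scaled A b {w} {y} {D} {Y} opt 0<D y≈
    in Face.pAdic-optimal {w} {y} {D} {Y} y≈ scaled pp (Face.integral-combination {w} {y} {D} {Y} y≈ scaled cond3)

cond1⇒cond2 : ∀ {m n} (A : Matrix m n) (b : IVec m) → Cond1 A b → Cond2 A b
cond1⇒cond2 A b cond1 = 2 , 3 , prime[2] , prime[3] , (λ ()) , cond1 2 prime[2] , cond1 3 prime[3]
  where
  prime[3] : Prime 3
  prime[3] = from-yes (prime? 3)

theorem1p4 : ∀ (m n : ℕ) (A : Matrix m n) (b : IVec m) →
    (Cond1 A b ⇔ Cond2 A b) × (Cond1 A b ⇔ Cond3 A b)
theorem1p4 m n A b =
  mk⇔ (cond1⇒cond2 A b) (cond3⇒cond1 A b ∘ cond2⇒cond3 A b) ,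
  mk⇔ (cond2⇒cond3 A b ∘ cond1⇒cond2 A b) (cond3⇒cond1 A b)
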